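{- Let $k$ and $n$ be integers with $n\geq k+2$ and $k\geq 3$. If $G$ is a connected $k$-regular graph of order $n$, then $$C(G)\leq 1-\frac{6}{k(k+1)},$$ with equality if and only if $n/(k+1)$ is an integer and $G$ is isomorphic to $G(k,n/(k+1))$.
   Context: All graphs are finite and simple. For a vertex $u$ of a graph $G$ with neighborhood $N_G(u)$ and degree $d_G(u)$, the clustering coefficient of $u$ is $C_u(G)=m(G[N_G(u)])/\binom{d_G(u)}{2}$ if $d_G(u)\geq 2$, and $C_u(G)=0$ otherwise, where $m(G[N_G(u)])$ is the number of edges of the subgraph induced by $N_G(u)$. The clustering coefficient of $G$ is $C(G)=\frac{1}{n(G)}\sum_{u\in V(G)}C_u(G)$, where $n(G)$ is the order of $G$. For integers $k\geq 3$ and $\ell\geq 2$, $G(k,\ell)$ is the $k$-regular connected graph obtained from $\ell$ disjoint copies $G_1,\ldots,G_\ell$ of $K_{k+1}-e$ ($K_{k+1}$ minus one edge) by adding, for every $i\in\{1,\ldots,\ell\}$, an edge between a vertex of $G_i$ and a vertex of $G_{i+1}$ (indices modulo $\ell$); the requirement of $k$-regularity determines $G(k,\ell)$ uniquely up to isomorphism (the added edges join the vertices of degree $k-1$ in the copies). -}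

module Defs where

open import Data.Bool using (Bool; true; false; _∧_; _∨_; not; if_then_else_)
open import Data.Nat using (ℕ; zero; suc; _+_; _*_; _<ᵇ_; _≡ᵇ_; NonZero)
open import Data.Nat.Combinatorics using (_C_; nCk+nC[k+1]≡[n+1]C[k+1]; nC1≡n)
open import Data.Fin using (Fin; toℕ; remQuot)
open import Data.List using (List; map; foldr; allFin)
open import Data.Nat.ListAction using (sum)
open import Data.Product using (_×_; _,_; Σ; proj₁; proj₂)
open import Data.Integer using (+_)
open import Data.Rational using (ℚ; _/_; 0ℚ; 1ℚ) renaming (_+_ to _+ℚ_; _*_ to _*ℚ_; _-_ to _-ℚ_)
open import Function.Bundles using (_↔_; Inverse)
open import Relation.Binary.PropositionalEquality using (_≡_; sym; refl; cong)
open import Data.Bool.Properties using (∨-comm)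

record Graph (n : ℕ) : Set where
  field
    adj    : Fin n → Fin n → Bool
    adj-sym    : ∀ u v → adj u v ≡ adj v u
    adj-irrefl : ∀ u → adj u u ≡ false
open Graph public

b2n : Bool → ℕ
b2n true  = 1
b2n false = 0

degree : ∀ {n} → Graph n → Fin n → ℕ
degree {n} G u = sum (map (λ v → b2n (adj G u v)) (allFin n))

nbhdEdges : ∀ {n} → Graph n → Fin n → ℕ
nbhdEdges {n} G u =
  sum (map (λ v → sum (map (λ w →
         b2n ((toℕ v <ᵇ toℕ w) ∧ adj G u v ∧ adj G u w ∧ adj G v w))
       (allFin n))) (allFin n))

choose2-nonZero : ∀ e → NonZero (suc (suc e) C 2)
choose2-nonZero e
  rewrite sym (nCk+nC[k+1]≡[n+1]C[k+1] (suc e) 1) | nC1≡n (suc e) = _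

ratioC : ℕ → ℕ → ℚ
ratioC m zero          = 0ℚ
ratioC m (suc zero)    = 0ℚ
ratioC m (suc (suc e)) = ((+ m) / (suc (suc e) C 2)) {{choose2-nonZero e}}

localClustering : ∀ {n} → Graph n → Fin n → ℚ
localClustering G u = ratioC (nbhdEdges G u) (degree G u)

sumℚ : List ℚ → ℚ
sumℚ = foldr _+ℚ_ 0ℚ

clustering : ∀ {n} → Graph n → ℚ
clustering {zero}  G = 0ℚ
clustering {suc n} G = ((+ 1) / suc n) *ℚ sumℚ (map (localClustering G) (allFin (suc n)))

Regular : ∀ {n} → ℕ → Graph n → Set
Regular k G = ∀ u → degree G u ≡ k

data Reach {n} (G : Graph n) : Fin n → Fin n → Set where
  here : ∀ {u} → Reach G u u
  step : ∀ {u v w} → adj G u v ≡ true → Reach G v w → Reach G u w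

Connected : ∀ {n} → Graph n → Set
Connected G = ∀ u v → Reach G u v

_≅_ : ∀ {n m} → Graph n → Graph m → Set
_≅_ {n} {m} G H =
  Σ (Fin n ↔ Fin m) λ f → ∀ u v → adj G u v ≡ adj H (Inverse.to f u) (Inverse.to f v)

-- The graph G(k, ℓ)
-- Vertex x of Fin (ℓ * (k+1)) is identified (via remQuot) with a pair
-- (i , p) : copy i ∈ Fin ℓ, position p ∈ Fin (k+1).  Copy i is K_{k+1}
-- minus the edge between positions 0 and 1; position 1 of copy i is joined
-- to position 0 of copy i+1 (mod ℓ).

isSuccMod : (ℓ a b : ℕ) → Bool
isSuccMod ℓ a b = (b ≡ᵇ suc a) ∨ ((b ≡ᵇ 0) ∧ (suc a ≡ᵇ ℓ))

rawAdjℕ : (ℓ i p j q : ℕ) → Bool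
rawAdjℕ ℓ i p j q =
    (not (p ≡ᵇ q) ∧ (i ≡ᵇ j)
       ∧ not (((p ≡ᵇ 0) ∧ (q ≡ᵇ 1)) ∨ ((p ≡ᵇ 1) ∧ (q ≡ᵇ 0))))
  ∨ ((q ≡ᵇ 0) ∧ (p ≡ᵇ 1) ∧ isSuccMod ℓ i j)
  ∨ ((p ≡ᵇ 0) ∧ (q ≡ᵇ 1) ∧ isSuccMod ℓ j i)

≡ᵇ-refl : ∀ n → (n ≡ᵇ n) ≡ true
≡ᵇ-refl zero    = refl
≡ᵇ-refl (suc n) = ≡ᵇ-refl n

rawAdjℕ-irrefl : ∀ ℓ i p → rawAdjℕ ℓ i p i p ≡ false
rawAdjℕ-irrefl ℓ i zero    = refl
rawAdjℕ-irrefl ℓ i (suc p) rewrite ≡ᵇ-refl p = refl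

rawAdj : (ℓ k : ℕ) → Fin ℓ × Fin (suc k) → Fin ℓ × Fin (suc k) → Bool
rawAdj ℓ k (i , p) (j , q) = rawAdjℕ ℓ (toℕ i) (toℕ p) (toℕ j) (toℕ q)

GklRaw : (k ℓ : ℕ) → Fin (ℓ * suc k) → Fin (ℓ * suc k) → Bool
GklRaw k ℓ x y = rawAdj ℓ k (remQuot (suc k) x) (remQuot (suc k) y)

GklRaw-irrefl : ∀ k ℓ x → GklRaw k ℓ x x ≡ false
GklRaw-irrefl k ℓ x =
  rawAdjℕ-irrefl ℓ (toℕ (proj₁ (remQuot {ℓ} (suc k) x))) (toℕ (proj₂ (remQuot {ℓ} (suc k) x)))

-- G(k, ℓ)  (meaningful for k ≥ 3, ℓ ≥ 2); adjacency symmetrised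
G[_,_] : (k ℓ : ℕ) → Graph (ℓ * suc k)
G[ k , ℓ ] = record
  { adj        = λ x y → GklRaw k ℓ x y ∨ GklRaw k ℓ y x
  ; adj-sym    = λ x y → ∨-comm (GklRaw k ℓ x y) (GklRaw k ℓ y x)
  ; adj-irrefl = λ x → cong (λ b → b ∨ b) (GklRaw-irrefl k ℓ x)
  }

-- the bound 1 - 6 / (k (k+1))   (k = 0 case irrelevant, set to 0)
clusteringBound : ℕ → ℚ
clusteringBound zero    = 0ℚ
clusteringBound (suc k) = 1ℚ -ℚ ((+ 6) / (suc k * suc (suc k)))

{-# OPTIONS --safe #-}
-- Let D(v) be twice the number of edges missing in N(v).  Then C(G) ≤ 1 − 6/(k(k+1)) says that D
-- averages at least 6(k−1)/(k+1), and since every vertex lies in k+1 closed neighbourhoods it is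
-- enough that T(u), the sum of D over N[u], is at least 6(k−1) for every u.  Connectivity gives
-- non-adjacent x, y ∈ N(u).  Missing edges at u, at x and y, and at the other neighbours of u are
-- counted separately (for a regular graph, the neighbours of u missed by x and the neighbours of x
-- missed by u are equally many), and yield T(u) ≥ 6(k−1) + r, where r is twice the number of missing edges of
-- N(u) disjoint from {x, y}.
--
-- In the case of equality any two missing edges of a neighbourhood meet, which forces D(v) = 2 or
-- D(v) ≥ 2(k−1) for each v; hence each N[u] contains a "center" v with D(v) = 2.  A center spans a
-- copy of K_{k+1} − e whose two non-centers ("ends") have one neighbour outside each.  Passing
-- alternately to the other end of a copy (mate) and to the outside neighbour (out) runs through the
-- copies cyclically and reaches all of them by connectivity.
module Submission where

open import Defs
open import Data.Bool using (Bool; true; false; not; _∧_)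
open import Data.Bool.Properties using (T-≡; ¬-not) renaming (_≟_ to _≟B_)
open import Data.Empty using (⊥; ⊥-elim)
open import Data.Fin using (Fin; zero; suc; toℕ; fromℕ<; remQuot; combine; _↑ˡ_; _↑ʳ_)
open import Data.Fin.Permutation using (Permutation; _⟨$⟩ʳ_; ↔⇒≡)
open import Data.Fin.Properties using (any?; toℕ-injective; toℕ<n; toℕ-fromℕ<; remQuot-combine; combine-remQuot; pigeonhole; splitAt-↑ʳ) renaming (_≟_ to _≟F_; suc-injective to suc-injectiveF)
open import Data.Integer using (+≤+) renaming (+_ to pos)
import Data.Integer as ℤ
import Data.Integer.Properties as ℤ
open import Data.List using ([]; _∷_; map; allFin; tabulate)
open import Data.List.Properties using (map-tabulate)
open import Data.Nat using (ℕ; zero; suc; _+_; _*_; _∸_; _≤_; _<_; _≤?_; _<ᵇ_; z≤n; s≤s; s≤s⁻¹; NonZero)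
open import Data.Nat.Combinatorics using (_C_; nCk+nC[k+1]≡[n+1]C[k+1]; nC1≡n)
open import Data.Nat.Induction using (<-rec)
import Data.Nat.ListAction as L
open import Data.Nat.Properties
open import Data.Nat.Tactic.RingSolver using (solve-∀)
open import Data.Product using (Σ; _×_; _,_; ∃; proj₁; proj₂)
open import Data.Product.Properties using (×-≡,≡→≡)
open import Data.Rational using (ℚ; _/_; 0ℚ; 1ℚ; toℚᵘ) renaming (_+_ to _+ℚ_; _*_ to _*ℚ_; _-_ to _-ℚ_; -_ to -ℚ_; _≤_ to _≤ℚ_)
import Data.Rational.Properties as ℚ
open import Data.Rational.Unnormalised using (mkℚᵘ; *≡*; *≤*; _≃_)
import Data.Rational.Unnormalised as ℚᵘ
import Data.Rational.Unnormalised.Properties as ℚᵘ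
open import Data.Sum using (_⊎_; inj₁; inj₂; [_,_]′)
open import Function using (_∘_; id; case_of_)
open import Function.Bundles using (_⇔_; _↔_; mk⇔; mk↔ₛ′; Equivalence; Inverse)
open import Relation.Binary.Definitions using (tri<; tri≈; tri>)
open import Relation.Binary.PropositionalEquality
open import Relation.Nullary using (¬_; Dec; yes; no; does; contradiction; ¬?; _×-dec_; _⊎-dec_)
import Algebra.Properties.CommutativeSemigroup +-commutativeSemigroup as +-CSG
import Algebra.Properties.CommutativeSemigroup *-commutativeSemigroup as *-CSG
import Algebra.Properties.Semiring.Sum +-*-semiring as S

-- The number 6(k-1) is the total of D over one copy of K_{k+1} - e in G(k, ℓ): the two ends
-- contribute 2(k-1) each and the k-1 centers 2 each; for a center u this copy is N[u]. The obstacle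
-- in the bound on T(u) is that x and y need not reach D = 2(k-1) on their own. Neighbours of u
-- adjacent to exactly one of x and y, and missing edges of N(u) avoiding both, weaken what can be
-- shown at x and y; but the same vertices and edges raise D(u) and D at the other neighbours of u,
-- and the losses are repaid in full once everything is added. That r survives this cancellation is
-- what makes the equality case accessible: it must vanish for every missing edge of every
-- neighbourhood. For G(k, ℓ) itself only upper bounds on D are established, since the general
-- inequality supplies the other direction. Throughout ℕ, terms are moved across inequalities
-- instead of being subtracted, so 6(k-1) ≤ T(u) reads `6 * k ≤ T u + 6`.

private variable N : ℕ

-- Finite sums of natural numbers.

-- Opaque, because unification cannot invert the fold that sum would unfold to.
opaque
  sum : (Fin N → ℕ) → ℕ
  sum = S.sum

  sum-cong-≗ : {f g : Fin N → ℕ} → (∀ i → f i ≡ g i) → sum f ≡ sum g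
  sum-cong-≗ = S.sum-cong-≗

  ∑-distrib-+ : (f g : Fin N → ℕ) → sum (λ i → f i + g i) ≡ sum f + sum g
  ∑-distrib-+ = S.∑-distrib-+

  ∑-comm : ∀ {m} (f : Fin m → Fin N → ℕ) → sum (λ i → sum (f i)) ≡ sum (λ j → sum (λ i → f i j))
  ∑-comm = S.∑-comm

  *-distribˡ-sum : ∀ a (f : Fin N → ℕ) → a * sum f ≡ sum (λ i → a * f i)
  *-distribˡ-sum = S.*-distribˡ-sum

  sum-permute : ∀ {m} (f : Fin N → ℕ) (π : Permutation m N) → sum f ≡ sum (λ i → f (π ⟨$⟩ʳ i))
  sum-permute = S.sum-permute

  sum-zero : {f : Fin N → ℕ} → (∀ i → f i ≡ 0) → sum f ≡ 0
  sum-zero {N} f≡0 = trans (sum-cong-≗ f≡0) (S.sum-replicate-zero N)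

  listSum≡sum : (f : Fin N → ℕ) → L.sum (map f (allFin N)) ≡ sum f
  listSum≡sum {N} f = trans (cong L.sum (map-tabulate id f)) (go f)
    where
    go : ∀ {N} (f : Fin N → ℕ) → L.sum (tabulate f) ≡ sum f
    go {zero}  f = refl
    go {suc N} f = cong (f zero +_) (go (f ∘ suc))

  sum-mono : {f g : Fin N → ℕ} → (∀ i → f i ≤ g i) → sum f ≤ sum g
  sum-mono {zero}  f≤g = z≤n
  sum-mono {suc N} f≤g = +-mono-≤ (f≤g zero) (sum-mono (f≤g ∘ suc))

  sum-const : ∀ N c → sum {N} (λ _ → c) ≡ N * c
  sum-const zero    c = refl
  sum-const (suc N) c = cong (c +_) (sum-const N c)

  term≤sum : (f : Fin N → ℕ) (i : Fin N) → f i ≤ sum f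
  term≤sum f zero    = m≤m+n _ _
  term≤sum f (suc i) = ≤-trans (term≤sum (f ∘ suc) i) (m≤n+m _ (f zero))

  two-terms≤sum : (f : Fin N → ℕ) {i j : Fin N} → i ≢ j → f i + f j ≤ sum f
  two-terms≤sum f {zero}  {zero}  i≢j = contradiction refl i≢j
  two-terms≤sum f {zero}  {suc j} i≢j = +-monoʳ-≤ (f zero) (term≤sum (f ∘ suc) j)
  two-terms≤sum f {suc i} {zero}  i≢j =
    subst (_≤ sum f) (+-comm (f zero) (f (suc i))) (+-monoʳ-≤ (f zero) (term≤sum (f ∘ suc) i))
  two-terms≤sum f {suc i} {suc j} i≢j =
    ≤-trans (two-terms≤sum (f ∘ suc) (i≢j ∘ cong suc)) (m≤n+m _ (f zero))

  three-terms≤sum : (f : Fin N → ℕ) {i j l : Fin N} → i ≢ j → i ≢ l → j ≢ l → f i + (f j + f l) ≤ sum f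
  three-terms≤sum f {zero}  {zero}  {l}     i≢j i≢l j≢l = contradiction refl i≢j
  three-terms≤sum f {zero}  {suc j} {zero}  i≢j i≢l j≢l = contradiction refl i≢l
  three-terms≤sum f {suc i} {zero}  {zero}  i≢j i≢l j≢l = contradiction refl j≢l
  three-terms≤sum f {zero}  {suc j} {suc l} i≢j i≢l j≢l =
    +-monoʳ-≤ (f zero) (two-terms≤sum (f ∘ suc) (j≢l ∘ cong suc))
  three-terms≤sum f {suc i} {zero}  {suc l} i≢j i≢l j≢l =
    ≤-trans (≤-reflexive (+-CSG.x∙yz≈y∙xz (f (suc i)) (f zero) (f (suc l))))
      (+-monoʳ-≤ (f zero) (two-terms≤sum (f ∘ suc) (i≢l ∘ cong suc)))
  three-terms≤sum f {suc i} {suc j} {zero}  i≢j i≢l j≢l =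
    ≤-trans (≤-reflexive (+-CSG.x∙yz≈z∙xy (f (suc i)) (f (suc j)) (f zero)))
      (+-monoʳ-≤ (f zero) (two-terms≤sum (f ∘ suc) (i≢j ∘ cong suc)))
  three-terms≤sum f {suc i} {suc j} {suc l} i≢j i≢l j≢l =
    ≤-trans (three-terms≤sum (f ∘ suc) (i≢j ∘ cong suc) (i≢l ∘ cong suc) (j≢l ∘ cong suc)) (m≤n+m _ (f zero))

  positive-term : (f : Fin N → ℕ) → 1 ≤ sum f → ∃ λ i → 1 ≤ f i
  positive-term {zero}  f ()
  positive-term {suc N} f 1≤ with f zero in eq
  ... | suc m = zero , ≤-trans (s≤s z≤n) (≤-reflexive (sym eq))
  ... | zero  with positive-term (f ∘ suc) 1≤
  ... | i , 1≤fi = suc i , 1≤fi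

  two-positive-terms : (f : Fin N → ℕ) → (∀ i → f i ≤ 1) → 2 ≤ sum f →
    ∃ λ i → ∃ λ j → i ≢ j × 1 ≤ f i × 1 ≤ f j
  two-positive-terms {zero}  f f≤1 ()
  two-positive-terms {suc N} f f≤1 2≤ with f zero in eq | f≤1 zero
  ... | suc zero | _ with i , 1≤fi ← positive-term (f ∘ suc) (s≤s⁻¹ 2≤) =
    zero , suc i , (λ ()) , ≤-reflexive (sym eq) , 1≤fi
  ... | zero     | _ with i , j , i≢j , 1≤fi , 1≤fj ← two-positive-terms (f ∘ suc) (f≤1 ∘ suc) 2≤ =
    suc i , suc j , (λ { refl → i≢j refl }) , 1≤fi , 1≤fj
  two-positive-terms {suc N} f f≤1 2≤ | suc (suc _) | s≤s ()

  sum-single : (f : Fin N → ℕ) (i : Fin N) → (∀ j → j ≢ i → f j ≡ 0) → sum f ≡ f i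
  sum-single f zero    h = trans (cong (f zero +_) (sum-zero (λ j → h (suc j) λ ()))) (+-identityʳ _)
  sum-single f (suc i) h =
    trans (cong (_+ sum (f ∘ suc)) (h zero λ ())) (sum-single (f ∘ suc) i (λ j j≢i → h (suc j) (λ { refl → j≢i refl })))

  sum-tight : (f g : Fin N → ℕ) → (∀ i → f i ≤ g i) → sum g ≤ sum f → ∀ i → g i ≤ f i
  sum-tight f g f≤g sg≤sf zero    =
    +-cancelʳ-≤ _ _ _ (≤-trans sg≤sf (+-monoʳ-≤ (f zero) (sum-mono (f≤g ∘ suc))))
  sum-tight f g f≤g sg≤sf (suc i) =
    sum-tight (f ∘ suc) (g ∘ suc) (f≤g ∘ suc)
      (+-cancelˡ-≤ (g zero) _ _ (≤-trans sg≤sf (+-monoˡ-≤ _ (f≤g zero)))) i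

opaque
  unfolding sum

  sum-suc : (f : Fin (suc N) → ℕ) → sum f ≡ f zero + sum (f ∘ suc)
  sum-suc f = refl

  sum-++ : ∀ m {r} (f : Fin (m + r) → ℕ) → sum f ≡ sum (λ i → f (i ↑ˡ r)) + sum (λ i → f (m ↑ʳ i))
  sum-++ zero    f = refl
  sum-++ (suc m) f = trans (cong (f zero +_) (sum-++ m (f ∘ suc))) (sym (+-assoc (f zero) _ _))

sum-remainder : ∀ ℓ m (h : Fin m → ℕ) → sum (λ x → h (proj₂ (remQuot {ℓ} m x))) ≡ ℓ * sum h
sum-remainder zero    m h = sum-zero λ ()
sum-remainder (suc ℓ) m h = trans (sum-++ m (λ x → h (proj₂ (remQuot {suc ℓ} m x)))) (cong₂ _+_
  (sum-cong-≗ λ i → cong h (cong proj₂ (remQuot-combine {suc ℓ} zero i)))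
  (trans (sum-cong-≗ λ x → cong h (remainder-↑ʳ x)) (sum-remainder ℓ m h)))
  where
  remainder-↑ʳ : ∀ x → proj₂ (remQuot {suc ℓ} m (m ↑ʳ x)) ≡ proj₂ (remQuot {ℓ} m x)
  remainder-↑ʳ x rewrite splitAt-↑ʳ m (ℓ * m) x = refl

-- Applied to the centers next to an end, in order to number the positions 2, ..., k of a copy.
record Enumeration (P : Fin N → Bool) (m : ℕ) : Set where
  field
    elem      : Fin m → Fin N
    injective : ∀ {i j} → elem i ≡ elem j → i ≡ j
    sound     : ∀ i → P (elem i) ≡ true
    complete  : ∀ {z} → P z ≡ true → ∃ λ i → elem i ≡ z

opaque
  unfolding sum

  enumerate : (P : Fin N → Bool) {m : ℕ} → sum (λ z → b2n (P z)) ≡ m → Enumeration P m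
  enumerate {zero}  P refl = record { elem = λ () ; injective = λ { {()} } ; sound = λ () ; complete = λ { {()} } }
  enumerate {suc N} P eq with P zero in P0
  enumerate {suc N} P {m} eq | false = record
    { elem      = suc ∘ elem
    ; injective = injective ∘ suc-injectiveF
    ; sound     = sound
    ; complete  = λ { {zero} Pz → case trans (sym P0) Pz of λ () ; {suc z} Pz → let i , e = complete Pz in i , cong suc e }
    }
    where open Enumeration (enumerate (P ∘ suc) eq)
  enumerate {suc N} P {suc m} eq | true = record
    { elem      = λ { zero → zero ; (suc i) → suc (elem i) }
    ; injective = λ { {zero} {zero} _ → refl ; {zero} {suc _} () ; {suc _} {zero} ()
                    ; {suc i} {suc j} e → cong suc (injective (suc-injectiveF e)) }
    ; sound     = λ { zero → P0 ; (suc i) → sound i }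
    ; complete  = λ { {zero} _ → zero , refl ; {suc z} Pz → let i , e = complete Pz in suc i , cong suc e }
    }
    where open Enumeration (enumerate (P ∘ suc) (suc-injective eq))

-- The weights stand for vertex sets; `1 ≤ p i` hands membership in the set to the termwise
-- inequality.
weighted-mono : (p : Fin N → ℕ) {f g : Fin N → ℕ} → (∀ i → 1 ≤ p i → f i ≤ g i) →
  sum (λ i → p i * f i) ≤ sum (λ i → p i * g i)
weighted-mono p {f} {g} f≤g = sum-mono λ i → go (p i) refl
  where
  go : ∀ {i} m → p i ≡ m → m * f i ≤ m * g i
  go     zero    _  = z≤n
  go {i} (suc m) eq = *-monoʳ-≤ (suc m) (f≤g i (≤-trans (s≤s z≤n) (≤-reflexive (sym eq))))

weighted-swap : (α β : Fin N → ℕ) (f : Fin N → Fin N → ℕ) →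
  sum (λ i → α i * sum (λ j → β j * f i j)) ≡ sum (λ j → β j * sum (λ i → α i * f i j))
weighted-swap α β f = begin
  sum (λ i → α i * sum (λ j → β j * f i j))      ≡⟨ sum-cong-≗ (λ i → *-distribˡ-sum (α i) _) ⟩
  sum (λ i → sum (λ j → α i * (β j * f i j)))    ≡⟨ ∑-comm _ ⟩
  sum (λ j → sum (λ i → α i * (β j * f i j)))
    ≡⟨ sum-cong-≗ (λ j → sum-cong-≗ (λ i → *-CSG.x∙yz≈y∙xz (α i) (β j) _)) ⟩
  sum (λ j → sum (λ i → β j * (α i * f i j)))    ≡⟨ sum-cong-≗ (λ j → *-distribˡ-sum (β j) _) ⟨
  sum (λ j → β j * sum (λ i → α i * f i j))      ∎
  where
  open ≡-Reasoning

sum-+* : (p f g : Fin N → ℕ) → sum (λ i → p i * (f i + g i)) ≡ sum (λ i → p i * f i) + sum (λ i → p i * g i)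
sum-+* p f g = trans (sum-cong-≗ (λ i → *-distribˡ-+ (p i) (f i) (g i))) (∑-distrib-+ _ _)

sum-*+ : (p q f : Fin N → ℕ) → sum (λ i → (p i + q i) * f i) ≡ sum (λ i → p i * f i) + sum (λ i → q i * f i)
sum-*+ p q f = trans (sum-cong-≗ (λ i → *-distribʳ-+ (f i) (p i) (q i))) (∑-distrib-+ _ _)

1≤*ˡ : ∀ a b → 1 ≤ a * b → 1 ≤ a
1≤*ˡ (suc a) b _ = s≤s z≤n

1≤*ʳ : ∀ a b → 1 ≤ a * b → 1 ≤ b
1≤*ʳ a b 1≤ab = 1≤*ˡ b a (subst (1 ≤_) (*-comm a b) 1≤ab)

off : Fin N → Fin N → ℕ
off x w = b2n (not (does (x ≟F w)))

sum-remove₂ : {x y : Fin N} → x ≢ y → (g : Fin N → ℕ) →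
  sum g ≡ g x + (g y + sum (λ w → off x w * off y w * g w))
sum-remove₂ {x = x} {y} x≢y g = begin
  sum g
    ≡⟨ sum-cong-≗ pointwise ⟩
  sum (λ w → on x w * g w + (on y w * g w + off x w * off y w * g w))
    ≡⟨ trans (∑-distrib-+ _ _) (cong₂ _+_ refl (∑-distrib-+ _ _)) ⟩
  sum (λ w → on x w * g w) + (sum (λ w → on y w * g w) + sum (λ w → off x w * off y w * g w))
    ≡⟨ cong₂ _+_ (sum-on x) (cong₂ _+_ (sum-on y) refl) ⟩
  g x + (g y + sum (λ w → off x w * off y w * g w)) ∎
  where
  open ≡-Reasoning
  on : Fin _ → Fin _ → ℕ
  on x w = b2n (does (x ≟F w))
  on-refl : ∀ x → on x x ≡ 1
  on-refl x with x ≟F x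
  ... | yes _  = refl
  ... | no x≢x = contradiction refl x≢x
  on-off : ∀ {x w} → w ≢ x → on x w * g w ≡ 0
  on-off {x} {w} w≢x with x ≟F w
  ... | yes x≡w = contradiction (sym x≡w) w≢x
  ... | no _    = refl
  sum-on : ∀ x → sum (λ w → on x w * g w) ≡ g x
  sum-on x = trans (sum-single (λ w → on x w * g w) x (λ w → on-off))
    (trans (cong (_* g x) (on-refl x)) (+-identityʳ _))
  pointwise : ∀ w → g w ≡ on x w * g w + (on y w * g w + off x w * off y w * g w)
  pointwise w with x ≟F w | y ≟F w
  ... | yes x≡w | yes y≡w = contradiction (trans x≡w (sym y≡w)) x≢y
  ... | yes _   | no _    = sym (trans (+-identityʳ _) (+-identityʳ _))
  ... | no _    | yes _   = sym (trans (+-identityʳ _) (+-identityʳ _))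
  ... | no _    | no _    = sym (+-identityʳ _)

-- Missing edges and the counts `c` and `D`.

module Counting {n : ℕ} (G : Graph n) where

  Adj : Fin n → Fin n → Set
  Adj u v = adj G u v ≡ true

  Far : Fin n → Fin n → Set
  Far u v = u ≢ v × adj G u v ≡ false

  A F δ : Fin n → Fin n → ℕ
  A u v = b2n (adj G u v)
  F u v = b2n (not (does (u ≟F v)) ∧ not (adj G u v))
  δ u v = b2n (does (u ≟F v))

  data Position (u v : Fin n) : Set where
    same     : u ≡ v → Position u v
    adjacent : Adj u v → Position u v
    far      : Far u v → Position u v

  position : ∀ u v → Position u v
  position u v with u ≟F v | adj G u v in eq
  ... | yes u≡v | _     = same u≡v
  ... | no _    | true  = adjacent eq
  ... | no u≢v  | false = far (u≢v , eq)

  Adj-sym : ∀ {u v} → Adj u v → Adj v u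
  Adj-sym {u} {v} uv = trans (adj-sym G v u) uv

  Adj⇒≢ : ∀ {u v} → Adj u v → u ≢ v
  Adj⇒≢ {u} uv refl with () ← trans (sym uv) (adj-irrefl G u)

  Far-sym : ∀ {u v} → Far u v → Far v u
  Far-sym {u} {v} (u≢v , uv) = u≢v ∘ sym , trans (adj-sym G v u) uv

  Adj⇒¬Far : ∀ {u v} → Adj u v → ¬ Far u v
  Adj⇒¬Far uv (_ , ¬uv) with () ← trans (sym uv) ¬uv

  A≡1 : ∀ {u v} → Adj u v → A u v ≡ 1
  A≡1 uv = cong b2n uv

  A≡0 : ∀ {u v} → Far u v → A u v ≡ 0
  A≡0 (_ , ¬uv) = cong b2n ¬uv

  A-refl : ∀ u → A u u ≡ 0
  A-refl u = cong b2n (adj-irrefl G u)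

  A-sym : ∀ u v → A u v ≡ A v u
  A-sym u v = cong b2n (adj-sym G u v)

  F≡1 : ∀ {u v} → Far u v → F u v ≡ 1
  F≡1 {u} {v} (u≢v , ¬uv) with u ≟F v
  ... | yes u≡v = contradiction u≡v u≢v
  ... | no _ rewrite ¬uv = refl

  F≡0 : ∀ {u v} → Adj u v → F u v ≡ 0
  F≡0 {u} {v} uv with u ≟F v
  ... | yes _ = refl
  ... | no _ rewrite uv = refl

  F-refl : ∀ u → F u u ≡ 0
  F-refl u with u ≟F u
  ... | yes _  = refl
  ... | no u≢u = contradiction refl u≢u

  F-sym : ∀ u v → F u v ≡ F v u
  F-sym u v with position u v
  ... | same refl   = refl
  ... | adjacent uv = trans (F≡0 uv) (sym (F≡0 (Adj-sym uv)))
  ... | far uv      = trans (F≡1 uv) (sym (F≡1 (Far-sym uv)))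

  1≤A : ∀ {u v} → 1 ≤ A u v → Adj u v
  1≤A {u} {v} 1≤ with adj G u v
  1≤A (s≤s _) | true = refl

  1≤F : ∀ {u v} → 1 ≤ F u v → Far u v
  1≤F {u} {v} 1≤ with u ≟F v | adj G u v
  1≤F ()      | yes _  | _
  1≤F ()      | no _   | true
  1≤F (s≤s _) | no u≢v | false = u≢v , refl

  opaque
    1≤A*F : ∀ {u v w z} → 1 ≤ A u v * F w z → Adj u v × Far w z
    1≤A*F {u} {v} {w} {z} 1≤ with position u v | position w z
    ... | adjacent uv | far wz = uv , wz
    ... | adjacent _  | same refl   rewrite F-refl w | *-zeroʳ (A u v) with () ← 1≤
    ... | adjacent _  | adjacent wz rewrite F≡0 wz   | *-zeroʳ (A u v) with () ← 1≤
    ... | same refl   | _ rewrite A-refl u with () ← 1≤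
    ... | far uv      | _ rewrite A≡0 uv with () ← 1≤

  A*F≤1 : ∀ u v w z → A u v * F w z ≤ 1
  A*F≤1 u v w z with position u v | position w z
  ... | same refl   | _ rewrite A-refl u = z≤n
  ... | far uv      | _ rewrite A≡0 uv = z≤n
  ... | adjacent uv | same refl rewrite F-refl w | *-zeroʳ (A u v) = z≤n
  ... | adjacent uv | adjacent wz rewrite F≡0 wz | *-zeroʳ (A u v) = z≤n
  ... | adjacent uv | far wz rewrite A≡1 uv | F≡1 wz = ≤-refl

  split : ∀ u (f : Fin n → ℕ) → sum f ≡ f u + (sum (λ v → A u v * f v) + sum (λ v → F u v * f v))
  split u f = begin
    sum f
      ≡⟨ sum-cong-≗ pointwise ⟩
    sum (λ v → δ u v * f v + (A u v * f v + F u v * f v))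
      ≡⟨ trans (∑-distrib-+ _ _) (cong₂ _+_ refl (∑-distrib-+ _ _)) ⟩
    sum (λ v → δ u v * f v) + (sum (λ v → A u v * f v) + sum (λ v → F u v * f v))
      ≡⟨ cong₂ _+_ (trans (sum-single (λ v → δ u v * f v) u δ-off) δ-on) refl ⟩
    f u + (sum (λ v → A u v * f v) + sum (λ v → F u v * f v)) ∎
    where
    open ≡-Reasoning
    δ-on : δ u u * f u ≡ f u
    δ-on with u ≟F u
    ... | yes _  = +-identityʳ _
    ... | no u≢u = contradiction refl u≢u
    δ-off : ∀ v → v ≢ u → δ u v * f v ≡ 0
    δ-off v v≢u with u ≟F v
    ... | yes u≡v = contradiction (sym u≡v) v≢u
    ... | no _    = refl
    pointwise : ∀ v → f v ≡ δ u v * f v + (A u v * f v + F u v * f v)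
    pointwise v with u ≟F v | adj G u v in eq
    ... | yes refl | true  with () ← trans (sym eq) (adj-irrefl G u)
    ... | yes refl | false = sym (trans (+-identityʳ _) (+-identityʳ _))
    ... | no _     | true  = sym (trans (+-identityʳ _) (+-identityʳ _))
    ... | no _     | false = sym (+-identityʳ _)

  -- For `a` in N(v) this is the number of missing edges of N(v) at `a`; in general it is the number
  -- of vertices of N(v) outside N[a]. One function serves both readings, so that `c-sym` can pass
  -- between them.
  c : Fin n → Fin n → ℕ
  c v a = sum (λ z → A v z * F z a)

  -- Twice the number of edges missing in the neighbourhood of v.
  D : Fin n → ℕ
  D v = sum (λ a → A v a * c v a)

  far-pair⇒1≤c : ∀ {v z a} → Adj v z → Far z a → 1 ≤ c v a
  far-pair⇒1≤c {v} {z} {a} vz za =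
    ≤-trans (≤-reflexive (sym (cong₂ _*_ (A≡1 vz) (F≡1 za)))) (term≤sum (λ z → A v z * F z a) z)

  opaque
    1≤c⇒far-pair : ∀ {v a} → 1 ≤ c v a → ∃ λ z → Adj v z × Far z a
    1≤c⇒far-pair 1≤c with positive-term _ 1≤c
    ... | z , 1≤ = z , 1≤A*F 1≤

module RegularCounting {n : ℕ} (G : Graph n) (k : ℕ) (regular : Regular k G) where
  open Counting G public

  sum-A : ∀ u → sum (A u) ≡ k
  sum-A u = trans (sym (listSum≡sum (A u))) (regular u)

  degree-split : ∀ v a → k ≡ A v a + (sum (λ z → A a z * A v z) + c v a)
  degree-split v a = trans (sym (sum-A v)) (trans (split a (A v))
    (cong (λ s → A v a + (sum (λ z → A a z * A v z) + s))
      (sum-cong-≗ λ z → trans (*-comm (F a z) (A v z)) (cong (A v z *_) (F-sym a z)))))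

  -- By `degree-split`, `c v a` is what remains of k after removing adjacency and the number of
  -- common neighbours, both symmetric in `v` and `a`.
  c-sym : ∀ v a → c v a ≡ c a v
  c-sym v a = +-cancelˡ-≡ (A v a + t v a) _ _ (begin
    (A v a + t v a) + c v a  ≡⟨ +-assoc (A v a) _ _ ⟩
    A v a + (t v a + c v a)  ≡⟨ degree-split v a ⟨
    k                        ≡⟨ degree-split a v ⟩
    A a v + (t a v + c a v)  ≡⟨ +-assoc (A a v) _ _ ⟨
    (A a v + t a v) + c a v  ≡⟨ cong (_+ c a v) (cong₂ _+_ (A-sym a v) (sum-cong-≗ λ z → *-comm (A v z) (A a z))) ⟩
    (A v a + t v a) + c a v  ∎)
    where
    open ≡-Reasoning
    t : Fin n → Fin n → ℕ
    t v a = sum (λ z → A a z * A v z)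

-- Lower bound for D at an end of a missing edge.

module LocalBound {n : ℕ} (G : Graph n) (k : ℕ) (regular : Regular k G) where
  open RegularCounting G k regular

  -- `Q` plays the indicator of N(u) without x and y. It is abstract so that the bound proved at x
  -- can be reused at y with the very same `Q`, and hence the same `R`.
  record Rest (u x y : Fin n) (Q : Fin n → ℕ) : Set where
    field
      sum-rest    : ∀ (f : Fin n → ℕ) → sum (λ w → A u w * f w) ≡ f x + (f y + sum (λ w → Q w * f w))
      inside-rest : ∀ {w} → 1 ≤ Q w → Adj u w × w ≢ x × w ≢ y

  Rest-swap : ∀ {u x y Q} → Rest u x y Q → Rest u y x Q
  Rest-swap {x = x} {y} r = record
    { sum-rest    = λ f → trans (sum-rest f) (+-CSG.x∙yz≈y∙xz (f x) (f y) _)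
    ; inside-rest = λ 1≤ → let (uw , w≢x , w≢y) = inside-rest 1≤ in uw , w≢y , w≢x
    }
    where open Rest r

  A+F≡1 : ∀ {x w} → w ≢ x → A x w + F x w ≡ 1
  A+F≡1 {x} {w} w≢x with position x w
  ... | same x≡w    = contradiction (sym x≡w) w≢x
  ... | adjacent xw = cong₂ _+_ (A≡1 xw) (F≡0 xw)
  ... | far xw      = cong₂ _+_ (A≡0 xw) (F≡1 xw)

  -- W counts the common neighbours of u and x, E the missing edges among them (as ordered pairs).
  -- A common neighbour w that is adjacent to an outside neighbour x′ of x has itself a non-neighbour
  -- in N(u), so W − M, where M counts the w far from x′, is paid for by missing edges of N(u).
  module EndBound {u x y : Fin n} {Q : Fin n → ℕ}
    (ux : Adj u x) (uy : Adj u y) (xy : Far x y) (rest : Rest u x y Q) where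
    open Rest rest

    R Y : ℕ
    R = sum (λ w → Q w * sum (λ z → Q z * F z w))
    Y = sum (λ w → Q w * (A x w * F y w))

    α β m m̄ s : Fin n → ℕ
    α w = Q w * A x w
    β w = Q w * F x w
    m a = sum (λ z → α z * F z a)
    m̄ a = sum (λ z → β z * F z a)
    s a = sum (λ z → Q z * F z a)

    p W E S F′ : ℕ
    p = c u x
    W = sum α
    E = sum (λ a → α a * m a)
    S = sum (λ a → α a * s a)
    F′ = sum (λ a → α a * m̄ a)

    Q-split : ∀ w → Q w ≡ α w + β w
    Q-split w with Q w in eq
    ... | zero  = refl
    ... | suc q = trans (sym (*-identityʳ (suc q)))
      (trans (cong (suc q *_) (sym (A+F≡1 (proj₁ (proj₂ (inside-rest (≤-trans (s≤s z≤n) (≤-reflexive (sym eq)))))))))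
        (*-distribˡ-+ (suc q) (A x w) (F x w)))

    common-nbr-sum : ∀ (f : Fin n → ℕ) → sum (λ w → A u w * (A x w * f w)) ≡ sum (λ w → α w * f w)
    common-nbr-sum f = trans (sum-rest (λ w → A x w * f w))
      (trans (cong₂ (λ a b → a * f x + (b * f y + sum (λ w → Q w * (A x w * f w)))) (A-refl x) (A≡0 xy))
        (sum-cong-≗ λ w → sym (*-assoc (Q w) (A x w) (f w))))

    s≡m+m̄ : ∀ a → s a ≡ m a + m̄ a
    s≡m+m̄ a = trans (sum-cong-≗ λ z → cong (_* F z a) (Q-split z)) (sum-*+ α β _)

    S≡E+F′ : S ≡ E + F′
    S≡E+F′ = trans (sum-cong-≗ λ w → cong (α w *_) (s≡m+m̄ w)) (sum-+* α m m̄)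

    F′≡ : F′ ≡ sum (λ w → β w * m w)
    F′≡ = trans (weighted-swap α β (λ a z → F z a))
      (sum-cong-≗ λ z → cong (β z *_) (sum-cong-≗ λ a → cong (α a *_) (F-sym z a)))

    -- `R` counts ordered pairs. Those whose second member is a common neighbour of u and x make up
    -- `S`; a mixed pair, with only one member adjacent to x, occurs a second time in the reverse
    -- order, which accounts for `F′`.
    S+F′≤R : S + F′ ≤ R
    S+F′≤R = begin
      S + F′                                ≡⟨ cong (S +_) F′≡ ⟩
      S + sum (λ w → β w * m w)             ≤⟨ +-monoʳ-≤ S (sum-mono λ w → *-monoʳ-≤ (β w)
                                                 (≤-trans (m≤m+n (m w) (m̄ w)) (≤-reflexive (sym (s≡m+m̄ w))))) ⟩
      S + sum (λ w → β w * s w)             ≡⟨ sum-*+ α β s ⟨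
      sum (λ w → (α w + β w) * s w)         ≡⟨ sum-cong-≗ (λ w → cong (_* s w) (Q-split w)) ⟨
      R                                     ∎
      where open ≤-Reasoning

    k≡1+W+p : k ≡ 1 + (W + p)
    k≡1+W+p = trans (degree-split u x) (cong₂ _+_ (A≡1 ux) (cong (_+ p) (begin
      sum (λ z → A x z * A u z)          ≡⟨ sum-cong-≗ (λ z → trans (*-comm (A x z) (A u z)) (cong (A u z *_) (sym (*-identityʳ (A x z))))) ⟩
      sum (λ z → A u z * (A x z * 1))    ≡⟨ common-nbr-sum (λ _ → 1) ⟩
      sum (λ z → α z * 1)                ≡⟨ sum-cong-≗ (λ z → *-identityʳ (α z)) ⟩
      W                                  ∎)))
      where open ≡-Reasoning

    -- A common neighbour w of u and x is not missed by x; being missed by y contributes to `Y`,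
    -- being missed by the remaining neighbours of u to `S`.
    sum-αc : sum (λ w → α w * c u w) ≡ Y + S
    sum-αc = trans (sum-cong-≗ pointwise) (∑-distrib-+ _ _)
      where
      AF≡0 : ∀ w → A x w * F x w ≡ 0
      AF≡0 w with position x w
      ... | same refl   = cong (_* F x x) (A-refl x)
      ... | adjacent xw = trans (cong (A x w *_) (F≡0 xw)) (*-zeroʳ (A x w))
      ... | far xw      = cong (_* F x w) (A≡0 xw)
      lemma : ∀ q a f g h → a * f ≡ 0 → q * a * (f + (g + h)) ≡ q * (a * g) + q * a * h
      lemma q a f g h af≡0 = begin
        q * a * (f + (g + h))                    ≡⟨ ring₁ q a f g h ⟩
        q * (a * f) + (q * (a * g) + q * a * h)  ≡⟨ cong (λ t → q * t + (q * (a * g) + q * a * h)) af≡0 ⟩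
        q * 0 + (q * (a * g) + q * a * h)        ≡⟨ cong (_+ (q * (a * g) + q * a * h)) (*-zeroʳ q) ⟩
        q * (a * g) + q * a * h                  ∎
        where
        open ≡-Reasoning
        ring₁ : ∀ q a f g h → q * a * (f + (g + h)) ≡ q * (a * f) + (q * (a * g) + q * a * h)
        ring₁ = solve-∀
      pointwise : ∀ w → α w * c u w ≡ Q w * (A x w * F y w) + α w * s w
      pointwise w = trans (cong (α w *_) (sum-rest (λ z → F z w)))
        (lemma (Q w) (A x w) (F x w) (F y w) (s w) (AF≡0 w))

    module _ {x′ : Fin n} (xx′ : Adj x x′) (ux′ : Far u x′) where

      M : ℕ
      M = sum (λ w → α w * F w x′)

      common-nbr : ∀ {w} → 1 ≤ α w → Adj u w × Adj x w
      common-nbr {w} 1≤α = proj₁ (inside-rest (1≤*ˡ (Q w) _ 1≤α)) , 1≤A (1≤*ʳ (Q w) _ 1≤α)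

      W≤M+Y+S : W ≤ M + (Y + S)
      W≤M+Y+S = begin
        W                                            ≡⟨ sum-cong-≗ (λ w → *-identityʳ (α w)) ⟨
        sum (λ w → α w * 1)                          ≤⟨ weighted-mono α pointwise ⟩
        sum (λ w → α w * (F w x′ + c u w))           ≡⟨ sum-+* α _ _ ⟩
        M + sum (λ w → α w * c u w)                  ≡⟨ cong (M +_) sum-αc ⟩
        M + (Y + S)                                  ∎
        where
        open ≤-Reasoning
        pointwise : ∀ w → 1 ≤ α w → 1 ≤ F w x′ + c u w
        pointwise w 1≤α with position w x′
        ... | same refl    = contradiction ux′ (Adj⇒¬Far (proj₁ (common-nbr 1≤α)))
        ... | far wx′      = ≤-trans (≤-reflexive (sym (F≡1 wx′))) (m≤m+n _ _)
        -- `x′` is a neighbour of `w` missed by `u`; `c-sym` trades it for a neighbour of `u` missed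
        -- by `w`.
        ... | adjacent wx′ = ≤-trans (far-pair⇒1≤c wx′ (Far-sym ux′))
          (≤-trans (≤-reflexive (c-sym w u)) (m≤n+m _ (F w x′)))

      c≥-outside : ∀ {a} → Far u a → 1 + m a ≤ c x a
      c≥-outside {a} ua = begin
        1 + m a                                   ≡⟨ cong₂ _+_ (sym (cong₂ _*_ (A≡1 (Adj-sym ux)) (F≡1 ua))) (sym (common-nbr-sum _)) ⟩
        A x u * F u a + inner                     ≤⟨ +-monoʳ-≤ (A x u * F u a) (m≤m+n inner _) ⟩
        A x u * F u a + (inner + outer)           ≡⟨ split u (λ z → A x z * F z a) ⟨
        c x a                                     ∎
        where
        open ≤-Reasoning
        inner outer : ℕ
        inner = sum (λ z → A u z * (A x z * F z a))
        outer = sum (λ z → F u z * (A x z * F z a))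

      c≥-inside : ∀ a → m a + F a x′ ≤ c x a
      c≥-inside a = begin
        m a + F a x′                     ≤⟨ +-mono-≤ (≤-reflexive (sym (common-nbr-sum _))) x′-term ⟩
        inner + outer                    ≤⟨ m≤n+m _ (A x u * F u a) ⟩
        A x u * F u a + (inner + outer)  ≡⟨ split u (λ z → A x z * F z a) ⟨
        c x a                            ∎
        where
        open ≤-Reasoning
        inner outer : ℕ
        inner = sum (λ z → A u z * (A x z * F z a))
        outer = sum (λ z → F u z * (A x z * F z a))
        x′-term : F a x′ ≤ outer
        x′-term = begin
          F a x′                          ≡⟨ F-sym a x′ ⟩
          F x′ a                          ≡⟨ trans (sym (+-identityʳ _)) (sym (+-identityʳ _)) ⟩
          1 * (1 * F x′ a)                ≡⟨ cong₂ (λ i j → i * (j * F x′ a)) (F≡1 ux′) (A≡1 xx′) ⟨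
          F u x′ * (A x x′ * F x′ a)      ≤⟨ term≤sum (λ z → F u z * (A x z * F z a)) x′ ⟩
          outer                           ∎

      -- N(x) is split into u, the common neighbours with u, and the p vertices outside N[u]. The
      -- row of u gives p. A common neighbour misses `m a` others and possibly x′, which sums to E +
      -- M. Each outside vertex misses u, which gives p, and x′ misses in addition the M common
      -- neighbours counted by `m x′`.
      D≥ : p + ((E + M) + (p + M)) ≤ D x
      D≥ = begin
        p + ((E + M) + (p + M))                         ≤⟨ +-mono-≤ at-u (+-mono-≤ inside outside) ⟩
        A x u * c x u + (sum (λ a → A u a * (A x a * c x a)) + sum (λ a → F u a * (A x a * c x a)))
                                                        ≡⟨ split u (λ a → A x a * c x a) ⟨
        D x                                             ∎
        where
        open ≤-Reasoning
        at-u : p ≤ A x u * c x u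
        at-u = ≤-reflexive (trans (c-sym u x) (trans (sym (+-identityʳ _)) (cong (_* c x u) (sym (A≡1 (Adj-sym ux))))))
        inside : E + M ≤ sum (λ a → A u a * (A x a * c x a))
        inside = begin
          E + M                                   ≡⟨ sum-+* α _ _ ⟨
          sum (λ a → α a * (m a + F a x′))        ≤⟨ sum-mono (λ a → *-monoʳ-≤ (α a) (c≥-inside a)) ⟩
          sum (λ a → α a * c x a)                 ≡⟨ common-nbr-sum _ ⟨
          sum (λ a → A u a * (A x a * c x a))     ∎
        outside : p + M ≤ sum (λ a → F u a * (A x a * c x a))
        outside = begin
          p + M
            ≡⟨ cong₂ _+_ (trans (c-sym u x) (sum-cong-≗ λ z →
                 trans (*-comm (A x z) (F z u)) (cong₂ _*_ (F-sym z u) (sym (*-identityʳ (A x z)))))) m-x′ ⟩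
          sum (λ a → F u a * (A x a * 1)) + F u x′ * (A x x′ * m x′)
            ≤⟨ +-monoʳ-≤ _ (term≤sum (λ a → F u a * (A x a * m a)) x′) ⟩
          sum (λ a → F u a * (A x a * 1)) + sum (λ a → F u a * (A x a * m a))
            ≡⟨ sum-+* (F u) _ _ ⟨
          sum (λ a → F u a * (A x a * 1 + A x a * m a))
            ≤⟨ weighted-mono (F u) (λ a 1≤F′ → ≤-trans (≤-reflexive (sym (*-distribˡ-+ (A x a) 1 (m a))))
                 (*-monoʳ-≤ (A x a) (c≥-outside (1≤F 1≤F′)))) ⟩
          sum (λ a → F u a * (A x a * c x a)) ∎
          where
          m-x′ : M ≡ F u x′ * (A x x′ * m x′)
          m-x′ = trans (trans (sym (+-identityʳ _)) (sym (+-identityʳ _)))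
            (sym (cong₂ (λ i j → i * (j * m x′)) (F≡1 ux′) (A≡1 xx′)))

    -- Doubling `W≤M+Y+S` costs 2M, 2E and 2F′. The 2M and one E are found in `D≥`; the remaining E
    -- + 2F′ equals S + F′ and is charged to R.
    end-bound : 2 * k ≤ D x + (R + (2 * Y + 2))
    end-bound with 1≤c⇒far-pair (subst (1 ≤_) (c-sym u x) (far-pair⇒1≤c uy (Far-sym xy)))
    ... | x′ , xx′ , x′u = begin
      2 * k                                                  ≡⟨ cong (2 *_) k≡1+W+p ⟩
      2 * (1 + (W + p))                                      ≡⟨ ring₁ W p ⟩
      2 * W + (2 * p + 2)                                    ≤⟨ +-monoˡ-≤ _ (*-monoʳ-≤ 2 (W≤M+Y+S xx′ ux′)) ⟩
      2 * (m* + (Y + S)) + (2 * p + 2)                       ≡⟨ cong (λ s → 2 * (m* + (Y + s)) + (2 * p + 2)) S≡E+F′ ⟩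
      2 * (m* + (Y + (E + F′))) + (2 * p + 2)                ≡⟨ ring₂ m* Y E F′ p ⟩
      p + ((E + m*) + (p + m*)) + (E + F′ + F′ + (2 * Y + 2)) ≡⟨ cong (λ s → p + ((E + m*) + (p + m*)) + (s + F′ + (2 * Y + 2))) S≡E+F′ ⟨
      p + ((E + m*) + (p + m*)) + (S + F′ + (2 * Y + 2))     ≤⟨ +-mono-≤ (D≥ xx′ ux′) (+-monoˡ-≤ _ S+F′≤R) ⟩
      D x + (R + (2 * Y + 2))                                ∎
      where
      open ≤-Reasoning
      ux′ : Far u x′
      ux′ = Far-sym x′u
      m* : ℕ
      m* = M xx′ ux′
      ring₁ : ∀ W p → 2 * (1 + (W + p)) ≡ 2 * W + (2 * p + 2)
      ring₁ = solve-∀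
      ring₂ : ∀ M Y E F′ p → 2 * (M + (Y + (E + F′))) + (2 * p + 2) ≡ p + ((E + M) + (p + M)) + (E + F′ + F′ + (2 * Y + 2))
      ring₂ = solve-∀

-- Lower bound for T, the sum of D over a closed neighbourhood.

module Excess {n : ℕ} (G : Graph n) (k : ℕ) (regular : Regular k G) where
  open RegularCounting G k regular
  open LocalBound G k regular

  rest : Fin n → Fin n → Fin n → Fin n → ℕ
  rest u x y w = A u w * (off x w * off y w)

  rest-Rest : ∀ {u x y} → Adj u x → Adj u y → x ≢ y → Rest u x y (rest u x y)
  rest-Rest {u} {x} {y} ux uy x≢y = record { sum-rest = sum-rest ; inside-rest = inside-rest }
    where
    sum-rest : ∀ (f : Fin n → ℕ) → sum (λ w → A u w * f w) ≡ f x + (f y + sum (λ w → rest u x y w * f w))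
    sum-rest f = trans (sum-remove₂ x≢y (λ w → A u w * f w))
      (cong₂ _+_ (at ux) (cong₂ _+_ (at uy) (sum-cong-≗ λ w → shuffle (off x w) (off y w) (A u w) (f w))))
      where
      at : ∀ {w} → Adj u w → A u w * f w ≡ f w
      at {w} uw = trans (cong (_* f w) (A≡1 uw)) (+-identityʳ (f w))
      shuffle : ∀ a b c d → a * b * (c * d) ≡ c * (a * b) * d
      shuffle = solve-∀
    off-≢ : ∀ {x w} → 1 ≤ off x w → w ≢ x
    off-≢ {x} {w} 1≤ refl with x ≟F x
    off-≢ () refl | yes _
    ... | no x≢x = x≢x refl
    inside-rest : ∀ {w} → 1 ≤ rest u x y w → Adj u w × w ≢ x × w ≢ y
    inside-rest {w} 1≤ = 1≤A (1≤*ˡ (A u w) _ 1≤)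
      , off-≢ (1≤*ˡ (off x w) _ (1≤*ʳ (A u w) _ 1≤))
      , off-≢ (1≤*ʳ (off x w) _ (1≤*ʳ (A u w) _ 1≤))

  rest≡1 : ∀ {u x y w} → Adj u w → w ≢ x → w ≢ y → rest u x y w ≡ 1
  rest≡1 uw w≢x w≢y = cong₂ _*_ (A≡1 uw) (cong₂ _*_ (off≡1 w≢x) (off≡1 w≢y))
    where
    off≡1 : ∀ {x w} → w ≢ x → off x w ≡ 1
    off≡1 {x} {w} w≢x with x ≟F w
    ... | yes x≡w = contradiction (sym x≡w) w≢x
    ... | no _    = refl

  -- Twice the number of missing edges in N(u) that are disjoint from {x, y}.
  disjointMissing : Fin n → Fin n → Fin n → ℕ
  disjointMissing u x y = sum (λ w → rest u x y w * sum (λ z → rest u x y z * F z w))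

  -- In N(w), the row of u contributes `c w u`, equal to `c u w`. There are equally many neighbours
  -- of w outside N[u], and each of them misses u. If w is adjacent to x and y, their missing edge
  -- counts in both orders.
  nbr-bound : ∀ {u x y w} → Adj u x → Adj u y → Far x y → Adj u w →
    2 * (A x w * A y w) + 2 * c u w ≤ D w
  nbr-bound {u} {x} {y} {w} ux uy xy uw = begin
    2 * (A x w * A y w) + 2 * c u w
      ≡⟨ ring₁ (A x w * A y w) (c u w) ⟩
    c u w + ((A x w * A y w + A x w * A y w) + c u w)
      ≤⟨ +-mono-≤ at-u (+-mono-≤ inside outside) ⟩
    A w u * c w u + (sum (λ a → A u a * (A w a * c w a)) + sum (λ a → F u a * (A w a * c w a)))
      ≡⟨ split u (λ a → A w a * c w a) ⟨
    D w ∎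
    where
    open ≤-Reasoning
    ring₁ : ∀ t c → 2 * t + 2 * c ≡ c + ((t + t) + c)
    ring₁ = solve-∀
    at-u : c u w ≤ A w u * c w u
    at-u = ≤-reflexive (trans (c-sym u w) (trans (sym (+-identityʳ _)) (cong (_* c w u) (sym (A≡1 (Adj-sym uw))))))
    outside : c u w ≤ sum (λ a → F u a * (A w a * c w a))
    outside = begin
      c u w                                ≡⟨ c-sym u w ⟩
      c w u                                ≡⟨ sum-cong-≗ (λ z → trans (*-comm (A w z) (F z u)) (cong₂ _*_ (F-sym z u) (sym (*-identityʳ (A w z))))) ⟩
      sum (λ a → F u a * (A w a * 1))
        ≤⟨ weighted-mono (F u) (λ a 1≤Fua → *-monoʳ-≤ (A w a) (far-pair⇒1≤c (Adj-sym uw) (1≤F 1≤Fua))) ⟩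
      sum (λ a → F u a * (A w a * c w a))  ∎
    row : ∀ {x y} → Adj u x → Far x y → A x w * A y w ≤ A u x * (A w x * c w x)
    row {x} {y} ux xy with position w x | position w y
    ... | same refl   | _ rewrite A-refl w = z≤n
    ... | far wx      | _ rewrite A≡0 (Far-sym wx) = z≤n
    ... | adjacent wx | same refl rewrite A-refl w | *-zeroʳ (A x w) = z≤n
    ... | adjacent wx | far wy rewrite A≡0 (Far-sym wy) | *-zeroʳ (A x w) = z≤n
    ... | adjacent wx | adjacent wy rewrite A≡1 ux | A≡1 wx | A≡1 (Adj-sym wx) | A≡1 (Adj-sym wy) =
      ≤-trans (far-pair⇒1≤c wy (Far-sym xy)) (≤-reflexive (sym (trans (+-identityʳ _) (+-identityʳ _))))
    inside : A x w * A y w + A x w * A y w ≤ sum (λ a → A u a * (A w a * c w a))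
    inside = begin
      A x w * A y w + A x w * A y w
        ≤⟨ +-mono-≤ (row ux xy) (≤-trans (≤-reflexive (*-comm (A x w) (A y w))) (row uy (Far-sym xy))) ⟩
      A u x * (A w x * c w x) + A u y * (A w y * c w y)
        ≤⟨ two-terms≤sum (λ a → A u a * (A w a * c w a)) (proj₁ xy) ⟩
      sum (λ a → A u a * (A w a * c w a)) ∎

  T : Fin n → ℕ
  T u = D u + sum (λ w → A u w * D w)

  -- D(x) and D(y) may fall short of 2(k-1) by R + 2Yx and R + 2Yy. By `mid` and `rest-bound`, D(u)
  -- together with the remaining neighbours exceeds 2(k-1) by at least 3R + 2Yx + 2Yy, which repays
  -- both shortfalls and leaves one R.
  local-bound : ∀ {u x y} → Adj u x → Adj u y → Far x y → 6 * k + disjointMissing u x y ≤ T u + 6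
  -- The cancelled term is the sum of the error terms of `x-bound` and `y-bound`.
  local-bound {u} {x} {y} ux uy xy = +-cancelʳ-≤ (2 * R + (2 * Yx + 2 * Yy) + 4) _ _ (begin
    6 * k + R + (2 * R + (2 * Yx + 2 * Yy) + 4)
      ≡⟨ ring₁ k R Yx Yy ⟩
    2 * k + 2 * k + (2 * k + (3 * R + (2 * Yx + 2 * Yy + 4)))
      ≤⟨ +-mono-≤ (+-mono-≤ x-bound y-bound) mid ⟩
    D x + (R + (2 * Yx + 2)) + (D y + (R + (2 * Yy + 2))) + (D u + (2 * Z + 2 * Σc) + 6)
      ≤⟨ +-monoʳ-≤ (D x + (R + (2 * Yx + 2)) + (D y + (R + (2 * Yy + 2)))) (+-monoˡ-≤ 6 (+-monoʳ-≤ (D u) rest-bound)) ⟩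
    D x + (R + (2 * Yx + 2)) + (D y + (R + (2 * Yy + 2))) + (D u + QD + 6)
      ≡⟨ ring₂ (D x) (D y) (D u) R Yx Yy QD ⟩
    D u + (D x + (D y + QD)) + 6 + (2 * R + (2 * Yx + 2 * Yy) + 4)
      ≡⟨ cong (λ t → D u + t + 6 + (2 * R + (2 * Yx + 2 * Yy) + 4)) (sum-rest D) ⟨
    T u + 6 + (2 * R + (2 * Yx + 2 * Yy) + 4) ∎)
    where
    open ≤-Reasoning
    Q : Fin n → ℕ
    Q = rest u x y
    Q-rest : Rest u x y Q
    Q-rest = rest-Rest ux uy (proj₁ xy)
    open Rest Q-rest
    R Yx Yy Z κ Σc QD Px Py : ℕ
    R = disjointMissing u x y
    Yx = sum (λ w → Q w * (A x w * F y w))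
    Yy = sum (λ w → Q w * (A y w * F x w))
    Z = sum (λ w → Q w * (A x w * A y w))
    κ = sum (λ w → Q w * (F x w * F y w))
    Σc = sum (λ w → Q w * c u w)
    QD = sum (λ w → Q w * D w)
    Px = sum (λ w → Q w * F x w)
    Py = sum (λ w → Q w * F y w)
    x-bound : 2 * k ≤ D x + (R + (2 * Yx + 2))
    x-bound = EndBound.end-bound ux uy xy Q-rest
    y-bound : 2 * k ≤ D y + (R + (2 * Yy + 2))
    y-bound = EndBound.end-bound uy ux (Far-sym xy) (Rest-swap Q-rest)
    rest-bound : 2 * Z + 2 * Σc ≤ QD
    rest-bound = begin
      2 * Z + 2 * Σc
        ≡⟨ cong₂ _+_ (double _) (double _) ⟩
      sum (λ w → Q w * (2 * (A x w * A y w))) + sum (λ w → Q w * (2 * c u w))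
        ≡⟨ sum-+* Q _ _ ⟨
      sum (λ w → Q w * (2 * (A x w * A y w) + 2 * c u w))
        ≤⟨ weighted-mono Q (λ w 1≤Q → nbr-bound ux uy xy (proj₁ (inside-rest 1≤Q))) ⟩
      QD ∎
      where
      double : ∀ (f : Fin n → ℕ) → 2 * sum (λ w → Q w * f w) ≡ sum (λ w → Q w * (2 * f w))
      double f = trans (*-distribˡ-sum 2 _) (sum-cong-≗ λ w → *-CSG.x∙yz≈y∙xz 2 (Q w) (f w))
    on-Q : (f g : Fin n → ℕ) → (∀ w → w ≢ x → w ≢ y → f w ≡ g w) → sum (λ w → Q w * f w) ≡ sum (λ w → Q w * g w)
    on-Q f g f≡g = ≤-antisym
      (weighted-mono Q (λ w 1≤Q → let (_ , w≢x , w≢y) = inside-rest 1≤Q in ≤-reflexive (f≡g w w≢x w≢y)))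
      (weighted-mono Q (λ w 1≤Q → let (_ , w≢x , w≢y) = inside-rest 1≤Q in ≤-reflexive (sym (f≡g w w≢x w≢y))))
    Px≡ : Px ≡ Yy + κ
    Px≡ = trans (on-Q _ _ λ w _ w≢y → trans (sym (*-identityʳ (F x w)))
        (trans (cong (F x w *_) (sym (A+F≡1 w≢y))) (trans (*-distribˡ-+ (F x w) (A y w) (F y w)) (cong (_+ F x w * F y w) (*-comm (F x w) (A y w))))))
      (sum-+* Q _ _)
    Py≡ : Py ≡ Yx + κ
    Py≡ = trans (on-Q _ _ λ w w≢x _ → trans (sym (+-identityʳ (F y w)))
        (trans (cong (_* F y w) (sym (A+F≡1 w≢x))) (*-distribʳ-+ (F y w) (A x w) (F x w))))
      (sum-+* Q _ _)
    k≡ : k ≡ 2 + (Z + Yx + (Yy + κ))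
    k≡ = begin-equality
      k                                           ≡⟨ sum-A u ⟨
      sum (A u)                                   ≡⟨ sum-cong-≗ (λ w → *-identityʳ (A u w)) ⟨
      sum (λ w → A u w * 1)                       ≡⟨ sum-rest (λ _ → 1) ⟩
      2 + sum (λ w → Q w * 1)                     ≡⟨ cong (2 +_) (on-Q _ _ λ w w≢x w≢y → sym (cong₂ _*_ (A+F≡1 w≢x) (A+F≡1 w≢y))) ⟩
      2 + sum (λ w → Q w * ((A x w + F x w) * (A y w + F y w)))
        ≡⟨ cong (2 +_) (sum-cong-≗ λ w → cong (Q w *_) (expand (A x w) (F x w) (A y w) (F y w))) ⟩
      2 + sum (λ w → Q w * (A x w * A y w + A x w * F y w + (A y w * F x w + F x w * F y w)))
        ≡⟨ cong (2 +_) (trans (sum-+* Q _ _) (cong₂ _+_ (sum-+* Q _ _) (sum-+* Q _ _))) ⟩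
      2 + (Z + Yx + (Yy + κ)) ∎
      where
      expand : ∀ a b c d → (a + b) * (c + d) ≡ a * c + a * d + (c * b + b * d)
      expand = solve-∀
    cx≡ : c u x ≡ 1 + Px
    cx≡ = trans (sum-rest (λ z → F z x)) (cong₂ _+_ (F-refl x)
      (cong₂ _+_ (F≡1 (Far-sym xy)) (sum-cong-≗ λ w → cong (Q w *_) (F-sym w x))))
    cy≡ : c u y ≡ 1 + Py
    cy≡ = trans (sum-rest (λ z → F z y)) (cong₂ _+_ (F≡1 xy)
      (cong₂ _+_ (F-refl y) (sum-cong-≗ λ w → cong (Q w *_) (F-sym w y))))
    Σc≡ : Σc ≡ Px + (Py + R)
    Σc≡ = trans (sum-cong-≗ λ w → cong (Q w *_) (sum-rest (λ z → F z w)))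
      (trans (sum-+* Q _ _) (cong₂ _+_ refl (sum-+* Q _ _)))
    Du≡ : D u ≡ 1 + (Yy + κ) + (1 + (Yx + κ) + (Yy + κ + (Yx + κ + R)))
    Du≡ = trans (sum-rest (c u)) (cong₂ _+_ (trans cx≡ (cong suc Px≡)) (cong₂ _+_ (trans cy≡ (cong suc Py≡))
      (trans Σc≡ (cong₂ _+_ Px≡ (cong₂ _+_ Py≡ refl)))))
    mid : 2 * k + (3 * R + (2 * Yx + 2 * Yy + 4)) ≤ D u + (2 * Z + 2 * Σc) + 6
    mid = begin
      2 * k + (3 * R + (2 * Yx + 2 * Yy + 4))
        ≡⟨ cong (λ k → 2 * k + (3 * R + (2 * Yx + 2 * Yy + 4))) k≡ ⟩
      2 * (2 + (Z + Yx + (Yy + κ))) + (3 * R + (2 * Yx + 2 * Yy + 4))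
        -- Vertices missed by both x and y only increase the right-hand side; their surplus 6κ is
        -- given away.
        ≤⟨ m≤m+n _ (6 * κ) ⟩
      2 * (2 + (Z + Yx + (Yy + κ))) + (3 * R + (2 * Yx + 2 * Yy + 4)) + 6 * κ
        ≡⟨ ring₃ Z Yx Yy κ R ⟩
      1 + (Yy + κ) + (1 + (Yx + κ) + (Yy + κ + (Yx + κ + R))) + (2 * Z + 2 * (Yy + κ + (Yx + κ + R))) + 6
        ≡⟨ cong₂ (λ d c → d + (2 * Z + 2 * c) + 6) Du≡ (trans Σc≡ (cong₂ _+_ Px≡ (cong₂ _+_ Py≡ refl))) ⟨
      D u + (2 * Z + 2 * Σc) + 6 ∎
      where
      ring₃ : ∀ Z Yx Yy κ R → 2 * (2 + (Z + Yx + (Yy + κ))) + (3 * R + (2 * Yx + 2 * Yy + 4)) + 6 * κ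
        ≡ 1 + (Yy + κ) + (1 + (Yx + κ) + (Yy + κ + (Yx + κ + R))) + (2 * Z + 2 * (Yy + κ + (Yx + κ + R))) + 6
      ring₃ = solve-∀
    ring₁ : ∀ k R Yx Yy → 6 * k + R + (2 * R + (2 * Yx + 2 * Yy) + 4)
      ≡ 2 * k + 2 * k + (2 * k + (3 * R + (2 * Yx + 2 * Yy + 4)))
    ring₁ = solve-∀
    ring₂ : ∀ dx dy du R Yx Yy QD →
      dx + (R + (2 * Yx + 2)) + (dy + (R + (2 * Yy + 2))) + (du + QD + 6)
      ≡ du + (dx + (dy + QD)) + 6 + (2 * R + (2 * Yx + 2 * Yy) + 4)
    ring₂ = solve-∀

  sum-T : sum T ≡ suc k * sum D
  sum-T = trans (∑-distrib-+ D _) (cong (sum D +_) (begin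
    sum (λ u → sum (λ w → A u w * D w))    ≡⟨ ∑-comm _ ⟩
    sum (λ w → sum (λ u → A u w * D w))    ≡⟨ sum-cong-≗ column ⟩
    sum (λ w → k * D w)                    ≡⟨ *-distribˡ-sum k D ⟨
    k * sum D                              ∎))
    where
    open ≡-Reasoning
    column : ∀ w → sum (λ u → A u w * D w) ≡ k * D w
    column w = begin
      sum (λ u → A u w * D w)  ≡⟨ sum-cong-≗ (λ u → trans (*-comm (A u w) (D w)) (cong (D w *_) (A-sym u w))) ⟩
      sum (λ u → D w * A w u)  ≡⟨ *-distribˡ-sum (D w) (A w) ⟨
      D w * sum (A w)          ≡⟨ trans (cong (D w *_) (sum-A w)) (*-comm (D w) k) ⟩
      k * D w                  ∎

  opaque
    another-nbr : 3 ≤ k → ∀ {u x y} → Adj u x → Adj u y → x ≢ y → ∃ λ w → Adj u w × w ≢ x × w ≢ y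
    another-nbr 3≤k {u} {x} {y} ux uy x≢y =
      let w , 1≤Qw = positive-term (λ w → rest u x y w * 1) 1≤ in w , inside-rest (1≤*ˡ (rest u x y w) 1 1≤Qw)
      where
      open Rest (rest-Rest ux uy x≢y)
      open ≤-Reasoning
      1≤ : 1 ≤ sum (λ w → rest u x y w * 1)
      1≤ = +-cancelˡ-≤ 2 _ _ (begin
        3                                   ≤⟨ 3≤k ⟩
        k                                   ≡⟨ sum-A u ⟨
        sum (A u)                           ≡⟨ sum-cong-≗ (λ w → *-identityʳ (A u w)) ⟨
        sum (λ w → A u w * 1)               ≡⟨ sum-rest (λ _ → 1) ⟩
        2 + sum (λ w → rest u x y w * 1)    ∎)

  unique-missing⇒D≡2 : ∀ {u x y} → Adj u x → Adj u y → Far x y →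
    (∀ w → Adj u w → w ≢ x → w ≢ y → ¬ 1 ≤ c u w) → D u ≡ 2
  unique-missing⇒D≡2 {u} {x} {y} ux uy xy none =
    trans (sum-rest (c u)) (cong₂ _+_ cx≡1 (cong₂ _+_ cy≡1 (sum-zero Qc≡0)))
    where
    open Rest (rest-Rest ux uy (proj₁ xy))
    Q : Fin n → ℕ
    Q = rest u x y
    1≤Q⇒c≡0 : ∀ {w} → 1 ≤ Q w → ¬ 1 ≤ c u w
    1≤Q⇒c≡0 {w} 1≤Q = let (uw , w≢x , w≢y) = inside-rest 1≤Q in none w uw w≢x w≢y
    Qc≡0 : ∀ w → Q w * c u w ≡ 0
    Qc≡0 w = n<1⇒n≡0 (≰⇒> λ 1≤ → 1≤Q⇒c≡0 (1≤*ˡ (Q w) _ 1≤) (1≤*ʳ (Q w) _ 1≤))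
    QF≡0 : ∀ {x} → Adj u x → ∀ w → Q w * F w x ≡ 0
    QF≡0 ux w = n<1⇒n≡0 (≰⇒> λ 1≤ →
      1≤Q⇒c≡0 (1≤*ˡ (Q w) _ 1≤) (far-pair⇒1≤c ux (Far-sym (1≤F (1≤*ʳ (Q w) _ 1≤)))))
    cx≡1 : c u x ≡ 1
    cx≡1 = trans (sum-rest (λ z → F z x)) (cong₂ _+_ (F-refl x) (cong₂ _+_ (F≡1 (Far-sym xy)) (sum-zero (QF≡0 ux))))
    cy≡1 : c u y ≡ 1
    cy≡1 = trans (sum-rest (λ z → F z y)) (cong₂ _+_ (F≡1 xy) (cong₂ _+_ (F-refl y) (sum-zero (QF≡0 uy))))

-- Missing edges from connectivity, and the summed inequality.

module Global {n : ℕ} (G : Graph n) (k : ℕ) (regular : Regular k G) (connected : Connected G) (k+2≤n : k + 2 ≤ n) where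
  open RegularCounting G k regular
  open Excess G k regular

  1≤far-count : ∀ u → 1 ≤ sum (λ z → F u z * 1)
  1≤far-count u = +-cancelˡ-≤ (suc k) 1 far-count (begin
    suc k + 1              ≡⟨ +-suc k 1 ⟨
    k + 2                  ≤⟨ k+2≤n ⟩
    n                      ≡⟨ *-identityʳ n ⟨
    n * 1                  ≡⟨ sum-const n 1 ⟨
    sum {n} (λ _ → 1)      ≡⟨ split u (λ _ → 1) ⟩
    1 + (sum (λ v → A u v * 1) + far-count)
      ≡⟨ cong (λ d → 1 + (d + far-count)) (trans (sum-cong-≗ λ v → *-identityʳ (A u v)) (sum-A u)) ⟩
    suc k + far-count      ∎)
    where
    open ≤-Reasoning
    far-count : ℕ
    far-count = sum (λ z → F u z * 1)

  far-vertex : ∀ u → ∃ λ z → Far u z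
  far-vertex u with z , 1≤ ← positive-term (λ z → F u z * 1) (1≤far-count u) = z , 1≤F (1≤*ˡ (F u z) 1 1≤)

  -- The walk starts in N[u] and ends outside, so some step leaves N[u]; that step cannot start at
  -- u, whose neighbours all lie inside.
  leaving-edge : ∀ {u v z} → Reach G v z → u ≡ v ⊎ Adj u v → Far u z → ∃ λ a → ∃ λ b → Adj u a × Adj a b × Far u b
  leaving-edge here (inj₁ refl) (u≢u , _) = contradiction refl u≢u
  leaving-edge here (inj₂ uv) uz = contradiction uz (Adj⇒¬Far uv)
  leaving-edge {u} (step {v = v′} vv′ path) near uz with position u v′
  ... | same u≡v′    = leaving-edge path (inj₁ u≡v′) uz
  ... | adjacent uv′ = leaving-edge path (inj₂ uv′) uz
  leaving-edge (step vv′ path) (inj₁ refl) uz | far uv′ = contradiction uv′ (Adj⇒¬Far vv′)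
  leaving-edge (step vv′ path) (inj₂ uv)   uz | far uv′ = _ , _ , uv , vv′ , uv′

  opaque
    missing-edge : ∀ u → ∃ λ x → ∃ λ y → Adj u x × Adj u y × Far x y
    missing-edge u with z , uz ← far-vertex u
      with a , b , ua , ab , ub ← leaving-edge (connected u z) (inj₁ refl) uz
      -- `b` is a neighbour of `a` missed by `u`; by `c-sym`, some neighbour `y` of `u` is missed by
      -- `a`.
      with y , uy , ya ← 1≤c⇒far-pair (subst (1 ≤_) (c-sym a u) (far-pair⇒1≤c ab (Far-sym ub)))
      = a , y , ua , uy , Far-sym ya

  6k≤T+6 : ∀ u → 6 * k ≤ T u + 6
  6k≤T+6 u with x , y , ux , uy , xy ← missing-edge u =
    ≤-trans (m≤m+n (6 * k) (disjointMissing u x y)) (local-bound ux uy xy)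

  sum-T+6 : sum (λ u → T u + 6) ≡ suc k * sum D + n * 6
  sum-T+6 = trans (∑-distrib-+ T (λ _ → 6)) (cong₂ _+_ sum-T (sum-const n 6))

  global-bound : n * (6 * k) ≤ suc k * sum D + n * 6
  global-bound = begin
    n * (6 * k)             ≡⟨ sum-const n (6 * k) ⟨
    sum {n} (λ _ → 6 * k)   ≤⟨ sum-mono 6k≤T+6 ⟩
    sum (λ u → T u + 6)     ≡⟨ sum-T+6 ⟩
    suc k * sum D + n * 6   ∎
    where open ≤-Reasoning

  -- The equality case: missing edges of a neighbourhood.

  module Tight (3≤k : 3 ≤ k) (tight : suc k * sum D + n * 6 ≤ n * (6 * k)) where

    T+6≤6k : ∀ u → T u + 6 ≤ 6 * k
    T+6≤6k = sum-tight (λ _ → 6 * k) (λ u → T u + 6) 6k≤T+6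
      (≤-trans (≤-reflexive sum-T+6) (≤-trans tight (≤-reflexive (sym (sum-const n (6 * k))))))

    missing-edges-meet : ∀ {u x y w z} → Adj u x → Adj u y → Far x y → Adj u w → Adj u z → Far w z →
      w ≢ x → w ≢ y → z ≢ x → z ≢ y → ⊥
    missing-edges-meet {u} {x} {y} {w} {z} ux uy xy uw uz wz w≢x w≢y z≢x z≢y =
      <-irrefl refl (begin-strict
        6 * k                          <⟨ m<m+n (6 * k) 1≤disjoint ⟩
        6 * k + disjointMissing u x y  ≤⟨ local-bound ux uy xy ⟩
        T u + 6                        ≤⟨ T+6≤6k u ⟩
        6 * k                          ∎)
      where
      open ≤-Reasoning
      1≤disjoint : 1 ≤ disjointMissing u x y
      1≤disjoint = begin
        1                                                           ≡⟨ cong₂ _*_ (rest≡1 uw w≢x w≢y) (cong₂ _*_ (rest≡1 uz z≢x z≢y) (F≡1 (Far-sym wz))) ⟨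
        rest u x y w * (rest u x y z * F z w)                       ≤⟨ *-monoʳ-≤ (rest u x y w) (term≤sum (λ z → rest u x y z * F z w) z) ⟩
        rest u x y w * sum (λ z → rest u x y z * F z w)             ≤⟨ term≤sum (λ w → rest u x y w * sum (λ z → rest u x y z * F z w)) w ⟩
        disjointMissing u x y                                       ∎

    meet-avoiding : ∀ {u x y w z} → Adj u x → Adj u y → Far x y → Adj u w → Adj u z → Far w z →
      w ≢ x → w ≢ y → z ≡ x ⊎ z ≡ y
    meet-avoiding {x = x} {y} {z = z} ux uy xy uw uz wz w≢x w≢y with z ≟F x | z ≟F y
    ... | yes z≡x | _       = inj₁ z≡x
    ... | no _    | yes z≡y = inj₂ z≡y
    ... | no z≢x  | no z≢y  = ⊥-elim (missing-edges-meet ux uy xy uw uz wz w≢x w≢y z≢x z≢y)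

    -- Once two missing edges of N(u) share `s`, the vertex `s` turns out to miss all of N(u), so
    -- D(u) is large.
    module Star {u s o w : Fin n} (us : Adj u s) (uo : Adj u o) (uw : Adj u w)
      (so : Far s o) (sw : Far s w) (o≢w : o ≢ w) where

      2≤c : 2 ≤ c s u
      2≤c = begin
        2                               ≡⟨ cong₂ _+_ (cong₂ _*_ (A≡1 uo) (F≡1 (Far-sym so))) (cong₂ _*_ (A≡1 uw) (F≡1 (Far-sym sw))) ⟨
        A u o * F o s + A u w * F w s   ≤⟨ two-terms≤sum (λ z → A u z * F z s) o≢w ⟩
        c u s                           ≡⟨ c-sym u s ⟩
        c s u                           ∎
        where open ≤-Reasoning

      two-outside : ∃ λ a → ∃ λ b → a ≢ b × (Adj s a × Far a u) × (Adj s b × Far b u)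
      two-outside with a , b , a≢b , 1≤a , 1≤b ← two-positive-terms (λ z → A s z * F z u) (λ z → A*F≤1 s z z u) 2≤c
        = a , b , a≢b , 1≤A*F 1≤a , 1≤A*F 1≤b

      -- If t missed some t′ in N(u), the missing edge tt′ would have to meet both so and sw; as t
      -- is none of s, o, w, either t′ = s, against st being an edge, or t′ = o = w. If t misses
      -- nothing in N(u), then by `c-sym` it has no neighbour outside N[u], so t misses b, and ua
      -- and tb are disjoint missing edges of N(s).
      not-adjacent : ∀ {t} → Adj u t → ¬ Adj s t
      not-adjacent {t} ut st with 1 ≤? c u t
      ... | yes 1≤c with t′ , ut′ , t′t ← 1≤c⇒far-pair 1≤c
        with meet-avoiding us uo so ut ut′ (Far-sym t′t) (Adj⇒≢ (Adj-sym st)) (λ { refl → Adj⇒¬Far st so })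
           | meet-avoiding us uw sw ut ut′ (Far-sym t′t) (Adj⇒≢ (Adj-sym st)) (λ { refl → Adj⇒¬Far st sw })
      ... | inj₁ refl | _         = Adj⇒¬Far st t′t
      ... | inj₂ _    | inj₁ refl = Adj⇒¬Far st t′t
      ... | inj₂ t′≡o | inj₂ t′≡w = o≢w (trans (sym t′≡o) t′≡w)
      not-adjacent {t} ut st | no c≡0 with a , b , a≢b , (sa , au) , (sb , bu) ← two-outside =
        missing-edges-meet (Adj-sym us) sa (Far-sym au) st sb tb
          (Adj⇒≢ (Adj-sym ut)) (λ { refl → Adj⇒¬Far (Adj-sym ut) au }) (proj₁ bu) (a≢b ∘ sym)
        where
        tb : Far t b
        tb with position t b
        ... | same refl   = contradiction bu (Adj⇒¬Far (Adj-sym ut))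
        ... | adjacent tb = contradiction (subst (1 ≤_) (c-sym t u) (far-pair⇒1≤c tb bu)) c≡0
        ... | far tb      = tb

      -- As u and s have no common neighbour, s misses the other k-1 neighbours of u. The row of s
      -- contributes k-1, and each of those k-1 neighbours at least 1.
      many-missing : 2 * k ≤ D u + 2
      many-missing = begin
        2 * k                                                ≡⟨ cong (2 *_) k≡ ⟩
        2 * (1 + c u s)                                      ≡⟨ ring₁ (c u s) ⟩
        c u s + c u s + 2                                    ≤⟨ +-monoˡ-≤ 2 (+-mono-≤ at-s (≤-trans elsewhere (m≤n+m _ _))) ⟩
        A u s * c u s + (sum (λ a → A s a * (A u a * c u a)) + sum (λ a → F s a * (A u a * c u a))) + 2
                                                             ≡⟨ cong (_+ 2) (split s (λ a → A u a * c u a)) ⟨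
        D u + 2                                              ∎
        where
        open ≤-Reasoning
        ring₁ : ∀ c → 2 * (1 + c) ≡ c + c + 2
        ring₁ = solve-∀
        no-common : ∀ z → A s z * A u z ≡ 0
        no-common z with position u z | position s z
        ... | same refl   | _ rewrite A-refl u = *-zeroʳ (A s u)
        ... | far uz      | _ rewrite A≡0 uz = *-zeroʳ (A s z)
        ... | adjacent uz | same refl rewrite A-refl s = refl
        ... | adjacent uz | far sz rewrite A≡0 sz = refl
        ... | adjacent uz | adjacent sz = ⊥-elim (not-adjacent uz sz)
        k≡ : k ≡ 1 + c u s
        k≡ = trans (degree-split u s) (cong₂ _+_ (A≡1 us) (cong (_+ c u s) (sum-zero no-common)))
        at-s : c u s ≤ A u s * c u s
        at-s = ≤-reflexive (trans (sym (+-identityʳ _)) (cong (_* c u s) (sym (A≡1 us))))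
        elsewhere : c u s ≤ sum (λ a → F s a * (A u a * c u a))
        elsewhere = begin
          c u s                               ≡⟨ sum-cong-≗ (λ z → trans (*-comm (A u z) (F z s)) (cong₂ _*_ (F-sym z s) (sym (*-identityʳ (A u z))))) ⟩
          sum (λ a → F s a * (A u a * 1))     ≤⟨ weighted-mono (F s) (λ a 1≤Fsa → *-monoʳ-≤ (A u a) (far-pair⇒1≤c us (1≤F 1≤Fsa))) ⟩
          sum (λ a → F s a * (A u a * c u a)) ∎

    one-or-many-missing : ∀ u → D u ≡ 2 ⊎ 2 * k ≤ D u + 2
    one-or-many-missing u with x , y , ux , uy , xy ← missing-edge u
      with any? (λ w → (adj G u w ≟B true) ×-dec (¬? (w ≟F x) ×-dec (¬? (w ≟F y) ×-dec (1 ≤? c u w))))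
    ... | yes (w , uw , w≢x , w≢y , 1≤c)
      with z , uz , zw ← 1≤c⇒far-pair 1≤c
      with meet-avoiding ux uy xy uw uz (Far-sym zw) w≢x w≢y
    ... | inj₁ refl = inj₂ (Star.many-missing ux uy uw xy zw (w≢y ∘ sym))
    ... | inj₂ refl = inj₂ (Star.many-missing uy ux uw (Far-sym xy) zw (w≢x ∘ sym))
    one-or-many-missing u | no none = inj₁ (unique-missing⇒D≡2 ux uy xy λ w uw w≢x w≢y 1≤c → none (w , uw , w≢x , w≢y , 1≤c))

    -- Otherwise all k+1 vertices of N[u] have D ≥ 2(k-1), and k ≥ 3 makes T(u) at least 8(k-1),
    -- more than the 6(k-1) that tightness allows.
    center-near : ∀ u → ∃ λ v → (u ≡ v ⊎ Adj u v) × D v ≡ 2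
    center-near u with one-or-many-missing u | any? (λ v → (adj G u v ≟B true) ×-dec (D v ≟ 2))
    ... | inj₁ Du≡2 | _                     = u , inj₁ refl , Du≡2
    ... | inj₂ _    | yes (v , uv , Dv≡2)   = v , inj₂ uv , Dv≡2
    ... | inj₂ 2k≤  | no none               = ⊥-elim (<-irrefl refl (begin-strict
      8 * k                                          <⟨ m<m+n (8 * k) (s≤s z≤n) ⟩
      8 * k + 4                                      ≡⟨ ring₁ k ⟩
      2 * k + 3 * (2 * k) + 4                        ≤⟨ +-monoˡ-≤ 4 (+-mono-≤ 2k≤ (*-monoˡ-≤ (2 * k) 3≤k)) ⟩
      D u + 2 + k * (2 * k) + 4                      ≤⟨ +-monoˡ-≤ 4 (+-monoʳ-≤ (D u + 2) nbrs) ⟩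
      D u + 2 + (sum (λ w → A u w * D w) + k * 2) + 4 ≡⟨ ring₂ (D u) (sum (λ w → A u w * D w)) k ⟩
      T u + 6 + 2 * k                                ≤⟨ +-monoˡ-≤ (2 * k) (T+6≤6k u) ⟩
      6 * k + 2 * k                                  ≡⟨ ring₃ k ⟩
      8 * k                                          ∎))
      where
      open ≤-Reasoning
      many : ∀ v → 1 ≤ A u v → 2 * k ≤ D v + 2
      many v 1≤Auv with one-or-many-missing v
      ... | inj₁ Dv≡2 = contradiction (v , 1≤A 1≤Auv , Dv≡2) none
      ... | inj₂ 2k≤  = 2k≤
      weighted-const : ∀ m → sum (λ w → A u w * m) ≡ k * m
      weighted-const m = trans (sum-cong-≗ λ w → *-comm (A u w) m)
        (trans (sym (*-distribˡ-sum m (A u))) (trans (cong (m *_) (sum-A u)) (*-comm m k)))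
      nbrs : k * (2 * k) ≤ sum (λ w → A u w * D w) + k * 2
      nbrs = begin
        k * (2 * k)                              ≡⟨ weighted-const (2 * k) ⟨
        sum (λ w → A u w * (2 * k))              ≤⟨ weighted-mono (A u) many ⟩
        sum (λ w → A u w * (D w + 2))            ≡⟨ sum-+* (A u) D (λ _ → 2) ⟩
        sum (λ w → A u w * D w) + sum (λ w → A u w * 2) ≡⟨ cong₂ _+_ refl (weighted-const 2) ⟩
        sum (λ w → A u w * D w) + k * 2          ∎
      ring₁ : ∀ k → 8 * k + 4 ≡ 2 * k + 3 * (2 * k) + 4
      ring₁ = solve-∀
      ring₂ : ∀ d s k → d + 2 + (s + k * 2) + 4 ≡ d + s + 6 + 2 * k
      ring₂ = solve-∀
      ring₃ : ∀ k → 6 * k + 2 * k ≡ 8 * k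
      ring₃ = solve-∀

-- Copies of K_{k+1} - e around centers, and their ends.

module Blocks {n : ℕ} (G : Graph n) (k : ℕ) (regular : Regular k G) (3≤k : 3 ≤ k)
  (center-near : ∀ u → ∃ λ v → (u ≡ v ⊎ Counting.Adj G u v) × Counting.D G v ≡ 2) where
  open RegularCounting G k regular
  open Excess G k regular

  Center End : Fin n → Set
  Center v = D v ≡ 2
  End v = ¬ Center v

  opaque
    center? : ∀ v → Dec (Center v)
    center? v = D v ≟ 2

  OneMissing : Fin n → Fin n → Fin n → Set
  OneMissing v x y = ∀ {a b} → Adj v a → Adj v b → Far a b → (a ≡ x × b ≡ y) ⊎ (a ≡ y × b ≡ x)

  opaque
    -- Every vertex lying on a missing edge of N(v) contributes at least 1 to D(v), so a third such
    -- vertex would give D(v) ≥ 3.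
    center⇒one-missing : ∀ {v} → Center v → ∃ λ x → ∃ λ y → Adj v x × Adj v y × Far x y × OneMissing v x y
    center⇒one-missing {v} Dv≡2
      with x , 1≤row ← positive-term (λ a → A v a * c v a) (subst (1 ≤_) (sym Dv≡2) (s≤s z≤n))
      with y , vy , yx ← 1≤c⇒far-pair (1≤*ʳ (A v x) _ 1≤row)
      = x , y , vx , vy , Far-sym yx , unique
      where
      open ≤-Reasoning
      vx : Adj v x
      vx = 1≤A (1≤*ˡ (A v x) _ 1≤row)
      row : ∀ {a b} → Adj v a → Adj v b → Far a b → 1 ≤ A v a * c v a
      row {a} va vb ab = begin
        1              ≤⟨ far-pair⇒1≤c vb (Far-sym ab) ⟩
        c v a          ≡⟨ +-identityʳ _ ⟨
        1 * c v a      ≡⟨ cong (_* c v a) (A≡1 va) ⟨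
        A v a * c v a  ∎
      among : ∀ {a b} → Adj v a → Adj v b → Far a b → a ≡ x ⊎ a ≡ y
      among {a} va vb ab with a ≟F x | a ≟F y
      ... | yes a≡x | _       = inj₁ a≡x
      ... | no _    | yes a≡y = inj₂ a≡y
      ... | no a≢x  | no a≢y  = ⊥-elim (<-irrefl refl (begin-strict
        2                                            <⟨ ≤-refl ⟩
        3                                            ≤⟨ +-mono-≤ (row va vb ab) (+-mono-≤ (row vx vy (Far-sym yx)) (row vy vx yx)) ⟩
        A v a * c v a + (A v x * c v x + A v y * c v y)
                                                     ≤⟨ three-terms≤sum (λ a → A v a * c v a) a≢x a≢y (proj₁ (Far-sym yx)) ⟩
        D v                                          ≡⟨ Dv≡2 ⟩
        2                                            ∎))
      unique : OneMissing v x y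
      unique va vb ab with among va vb ab | among vb va (Far-sym ab)
      ... | inj₁ a≡x | inj₁ b≡x = contradiction (trans a≡x (sym b≡x)) (proj₁ ab)
      ... | inj₁ a≡x | inj₂ b≡y = inj₁ (a≡x , b≡y)
      ... | inj₂ a≡y | inj₁ b≡x = inj₂ (a≡y , b≡x)
      ... | inj₂ a≡y | inj₂ b≡y = contradiction (trans a≡y (sym b≡y)) (proj₁ ab)

  opaque
    far-unique : ∀ {v a a′ b} → Center v → Adj v a → Adj v a′ → Adj v b → Far a b → Far a′ b → a ≡ a′
    far-unique Cv va va′ vb ab a′b with x , y , _ , _ , xy , one ← center⇒one-missing Cv
      with one va vb ab | one va′ vb a′b
    ... | inj₁ (a≡x , _)  | inj₁ (a′≡x , _) = trans a≡x (sym a′≡x)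
    ... | inj₂ (a≡y , _)  | inj₂ (a′≡y , _) = trans a≡y (sym a′≡y)
    ... | inj₁ (_ , refl) | inj₂ (_ , refl) = contradiction refl (proj₁ xy)
    ... | inj₂ (_ , refl) | inj₁ (_ , refl) = contradiction refl (proj₁ xy)

  two-far⇒2≤c : ∀ {u a b v} → a ≢ b → Adj u a → Adj u b → Far a v → Far b v → 2 ≤ c u v
  two-far⇒2≤c {u} {a} {b} {v} a≢b ua ub av bv = begin
    2                              ≡⟨ cong₂ _+_ (cong₂ _*_ (A≡1 ua) (F≡1 av)) (cong₂ _*_ (A≡1 ub) (F≡1 bv)) ⟨
    A u a * F a v + A u b * F b v  ≤⟨ two-terms≤sum (λ z → A u z * F z v) a≢b ⟩
    c u v                          ∎
    where open ≤-Reasoning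

  -- By the symmetry of c, far-unique also holds seen from the other end of the edge.
  far-unique′ : ∀ {v u a b} → Center v → Adj v u → Adj u a → Adj u b → Far a v → Far b v → a ≡ b
  far-unique′ {v} {u} {a} {b} Cv vu ua ub av bv with a ≟F b
  ... | yes a≡b = a≡b
  ... | no a≢b with z , z′ , z≢z′ , 1≤z , 1≤z′ ←
      two-positive-terms (λ z → A v z * F z u) (λ z → A*F≤1 v z z u)
        (subst (2 ≤_) (c-sym u v) (two-far⇒2≤c a≢b ua ub av bv))
    with vz , zu ← 1≤A*F {v} {z} 1≤z | vz′ , z′u ← 1≤A*F {v} {z′} 1≤z′
    = contradiction (far-unique Cv vz vz′ vu zu z′u) z≢z′

  -- For adjacent v and w this is N[v] = N[w].
  SameClosed : Fin n → Fin n → Set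
  SameClosed v w = (∀ {z} → Adj w z → z ≡ v ⊎ Adj v z) × (∀ {z} → Adj v z → z ≡ w ⊎ Adj w z)

  c≡0⇒ : ∀ {v w} → ¬ 1 ≤ c v w → ∀ {z} → Adj v z → z ≡ w ⊎ Adj w z
  c≡0⇒ {v} {w} c≡0 {z} vz with position z w
  ... | same z≡w    = inj₁ z≡w
  ... | adjacent zw = inj₂ (Adj-sym zw)
  ... | far zw      = contradiction (far-pair⇒1≤c vz zw) c≡0

  -- N[v] spans K_{k+1} with the edge xy removed, and every vertex of it other than x and y sees
  -- exactly this set as its closed neighbourhood.
  record Block (v x y : Fin n) : Set where
    field
      vx   : Adj v x
      vy   : Adj v y
      xy   : Far x y
      twin : ∀ {w} → Adj v w → w ≢ x → w ≢ y → Center w × SameClosed v w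
      endx : End x
      endy : End y

    end-among : ∀ {z} → Adj v z → End z → z ≡ x ⊎ z ≡ y
    end-among {z} vz Ez with z ≟F x | z ≟F y
    ... | yes z≡x | _       = inj₁ z≡x
    ... | no _    | yes z≡y = inj₂ z≡y
    ... | no z≢x  | no z≢y  = contradiction (proj₁ (twin vz z≢x z≢y)) Ez

  opaque
    -- A neighbour w of v off the missing edge has c(v, w) = 0, hence also c(w, v) = 0. The closed
    -- neighbourhoods of v and w therefore agree, and w inherits the single missing edge.
    block : ∀ {v} → Center v → ∃ λ x → ∃ λ y → Block v x y
    block {v} Cv with x , y , vx , vy , xy , one ← center⇒one-missing Cv = x , y , record
      { vx = vx ; vy = vy ; xy = xy ; twin = twin
      ; endx = not-center vx vy xy (λ vw w≢x w≢y → twin vw w≢x w≢y)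
      ; endy = not-center vy vx (Far-sym xy) (λ vw w≢y w≢x → twin vw w≢x w≢y) }
      where
      twin : ∀ {w} → Adj v w → w ≢ x → w ≢ y → Center w × SameClosed v w
      twin {w} vw w≢x w≢y = unique-missing⇒D≡2 wx wy xy none , w⊆v , v⊆w
        where
        c≡0 : ¬ 1 ≤ c v w
        c≡0 1≤c with z , vz , zw ← 1≤c⇒far-pair 1≤c with one vz vw zw
        ... | inj₁ (_ , w≡y) = w≢y w≡y
        ... | inj₂ (_ , w≡x) = w≢x w≡x
        v⊆w : ∀ {z} → Adj v z → z ≡ w ⊎ Adj w z
        v⊆w = c≡0⇒ c≡0
        w⊆v : ∀ {z} → Adj w z → z ≡ v ⊎ Adj v z
        w⊆v = c≡0⇒ (λ 1≤c → c≡0 (subst (1 ≤_) (c-sym w v) 1≤c))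
        wx : Adj w x
        wx with v⊆w vx
        ... | inj₁ x≡w = contradiction (sym x≡w) w≢x
        ... | inj₂ wx  = wx
        wy : Adj w y
        wy with v⊆w vy
        ... | inj₁ y≡w = contradiction (sym y≡w) w≢y
        ... | inj₂ wy  = wy
        none : ∀ a → Adj w a → a ≢ x → a ≢ y → ¬ 1 ≤ c w a
        none a wa a≢x a≢y 1≤c with b , wb , ba ← 1≤c⇒far-pair 1≤c with w⊆v wa | w⊆v wb
        ... | inj₁ refl | inj₁ refl = proj₁ ba refl
        ... | inj₁ refl | inj₂ vb   = Adj⇒¬Far (Adj-sym vb) ba
        ... | inj₂ va   | inj₁ refl = Adj⇒¬Far va ba
        ... | inj₂ va   | inj₂ vb with one vb va ba
        ... | inj₁ (_ , a≡y) = a≢y a≡y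
        ... | inj₂ (_ , a≡x) = a≢x a≡x
      -- Since x misses y in N(v), it has a neighbour x′ outside N[v]. Both v and a twin w are
      -- neighbours of x that miss x′, which is impossible at a center; k ≥ 3 provides the twin.
      not-center : ∀ {x y} → Adj v x → Adj v y → Far x y →
        (∀ {w} → Adj v w → w ≢ x → w ≢ y → Center w × SameClosed v w) → End x
      not-center {x} {y} vx vy xy twin Cx
        with w , vw , w≢x , w≢y ← another-nbr 3≤k vx vy (proj₁ xy)
        with _ , w⊆v , v⊆w ← twin vw w≢x w≢y
        with x′ , xx′ , x′v ← 1≤c⇒far-pair (subst (1 ≤_) (c-sym v x) (far-pair⇒1≤c vy (Far-sym xy)))
        with v⊆w vx
      ... | inj₁ x≡w = w≢x (sym x≡w)
      ... | inj₂ wx  = Adj⇒≢ vw (far-unique Cx (Adj-sym vx) (Adj-sym wx) xx′ (Far-sym x′v) wx′)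
        where
        wx′ : Far w x′
        wx′ with position w x′
        ... | same refl    = contradiction x′v (Adj⇒¬Far (Adj-sym vw))
        ... | far wx′      = wx′
        ... | adjacent wx′ with w⊆v wx′
        ... | inj₁ refl = contradiction refl (proj₁ x′v)
        ... | inj₂ vx′  = contradiction x′v (Adj⇒¬Far (Adj-sym vx′))

  adjacent-centers : ∀ {v w} → Center v → Center w → Adj v w → SameClosed v w
  adjacent-centers Cv Cw vw with x , y , b ← block Cv =
    proj₂ (Block.twin b vw (λ { refl → Block.endx b Cw }) (λ { refl → Block.endy b Cw }))

  -- If v and v′ were not adjacent, a twin w of v would miss v′ as well, and u would have two
  -- neighbours missed by the center v′, against `far-unique′`. This is why an end belongs to one
  -- copy only.
  centers-at-end : ∀ {u v v′} → End u → Center v → Center v′ → Adj u v → Adj u v′ → v′ ≡ v ⊎ Adj v v′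
  centers-at-end {u} {v} {v′} Eu Cv Cv′ uv uv′ with position v v′
  ... | same v≡v′    = inj₁ (sym v≡v′)
  ... | adjacent vv′ = inj₂ vv′
  ... | far vv′ with x , y , b ← block Cv
    with w , vw , w≢x , w≢y ← another-nbr 3≤k (Block.vx b) (Block.vy b) (proj₁ (Block.xy b))
    with Cw , w⊆v , v⊆w ← Block.twin b vw w≢x w≢y
    with v⊆w (Adj-sym uv)
  ... | inj₁ refl = contradiction Cw Eu
  ... | inj₂ wu   = contradiction (far-unique′ Cv′ (Adj-sym uv′) uv (Adj-sym wu) vv′ wv′) (Adj⇒≢ vw)
    where
    wv′ : Far w v′
    wv′ with position w v′
    ... | same refl    = contradiction vv′ (Adj⇒¬Far vw)
    ... | far wv′      = wv′
    ... | adjacent wv′ with w⊆v wv′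
    ... | inj₁ v′≡v = contradiction (sym v′≡v) (proj₁ vv′)
    ... | inj₂ vv″  = contradiction vv′ (Adj⇒¬Far vv″)

  center-at-end : ∀ {x} → End x → ∃ λ v → Center v × ∃ λ y → Block v x y
  center-at-end {x} Ex with center-near x
  ... | v , inj₁ refl , Cv = contradiction Cv Ex
  ... | v , inj₂ xv , Cv with a , b , blk ← block Cv with Block.end-among blk (Adj-sym xv) Ex
  ... | inj₁ refl = v , Cv , b , blk
  ... | inj₂ refl = v , Cv , a , record
    { vx = vy ; vy = vx ; xy = Far-sym xy ; twin = λ vw w≢x w≢y → twin vw w≢y w≢x ; endx = endy ; endy = endx }
    where open Block blk

  -- y is the other end of the copy containing x, and x′ the neighbour of x outside it. The last
  -- three fields speak of every center at an end, so that later arguments are independent of the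
  -- chosen `center`.
  record EndData (x y x′ : Fin n) : Set where
    field
      out-adj    : Adj x x′
      out-end    : End x′
      out-unique : ∀ {z} → Adj x z → End z → z ≡ x′
      mate-end   : End y
      mate-far   : Far x y
      center     : Fin n
      center-C   : Center center
      center-adj : Adj center x
      mate-to    : ∀ {v} → Center v → Adj v x → Adj v y
      mate-from  : ∀ {v} → Center v → Adj v y → Adj v x
      ends       : ∀ {v z} → Center v → Adj v x → Adj v z → End z → z ≡ x ⊎ z ≡ y

  opaque
    end-data : ∀ {x} → End x → ∃ λ y → ∃ λ x′ → EndData x y x′
    end-data {x} Ex with v , Cv , y , blk ← center-at-end Ex
      with x′ , xx′ , x′v ← 1≤c⇒far-pair (subst (1 ≤_) (c-sym v x)
             (far-pair⇒1≤c (Block.vy blk) (Far-sym (Block.xy blk))))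
      = y , x′ , record
      { out-adj    = xx′
      ; out-end    = λ Cx′ → [ (λ x′≡v → proj₁ x′v x′≡v) , (λ vx′ → Adj⇒¬Far (Adj-sym vx′) x′v) ]′
                       (centers-at-end Ex Cv Cx′ (Adj-sym vx) xx′)
      -- An end next to x lies outside N[v], and by `far-unique′` x has at most one neighbour there.
      ; out-unique = λ xz Ez → far-unique′ Cv vx xz xx′ (Far-sym (outside xz Ez)) x′v
      ; mate-end   = endy
      ; mate-far   = xy
      ; center     = v
      ; center-C   = Cv
      ; center-adj = vx
      ; mate-to    = λ Cw wx → transfer Cw (centers-at-end Ex Cv Cw (Adj-sym vx) (Adj-sym wx)) endy vy
      ; mate-from  = λ Cw wy → transfer Cw (centers-at-end endy Cv Cw (Adj-sym vy) (Adj-sym wy)) Ex vx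
      ; ends       = λ Cw wx wz Ez → end-among
                       (transfer-back Cw (centers-at-end Ex Cv Cw (Adj-sym vx) (Adj-sym wx)) Ez wz) Ez
      }
      where
      open Block blk
      outside : ∀ {z} → Adj x z → End z → Far v z
      outside {z} xz Ez with position v z
      ... | same refl   = contradiction Cv Ez
      ... | far vz      = vz
      ... | adjacent vz with end-among vz Ez
      ... | inj₁ refl = contradiction refl (Adj⇒≢ xz)
      ... | inj₂ refl = contradiction xy (Adj⇒¬Far xz)
      transfer : ∀ {w z} → Center w → w ≡ v ⊎ Adj v w → End z → Adj v z → Adj w z
      transfer Cw (inj₁ refl) Ez vz = vz
      transfer Cw (inj₂ vw) Ez vz with proj₂ (adjacent-centers Cv Cw vw) vz
      ... | inj₁ refl = contradiction Cw Ez
      ... | inj₂ wz   = wz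
      transfer-back : ∀ {w z} → Center w → w ≡ v ⊎ Adj v w → End z → Adj w z → Adj v z
      transfer-back Cw (inj₁ refl) Ez wz = wz
      transfer-back Cw (inj₂ vw) Ez wz with proj₁ (adjacent-centers Cv Cw vw) wz
      ... | inj₁ refl = contradiction Cv Ez
      ... | inj₂ vz   = vz

-- Adjacency in G(k, ℓ) as a relation on labels.

Next : (ℓ i j : ℕ) → Set
Next ℓ i j = j ≡ suc i ⊎ (j ≡ 0 × suc i ≡ ℓ)

next? : ∀ ℓ i j → Dec (Next ℓ i j)
next? ℓ i j = (j ≟ suc i) ⊎-dec ((j ≟ 0) ×-dec (suc i ≟ ℓ))

next : ∀ {ℓ} → 1 ≤ ℓ → (i : Fin ℓ) → ∃ λ (j : Fin ℓ) → Next ℓ (toℕ i) (toℕ j)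
next {ℓ} 1≤ℓ i with m≤n⇒m<n∨m≡n (toℕ<n i)
... | inj₁ i+1<ℓ = fromℕ< i+1<ℓ , inj₁ (toℕ-fromℕ< i+1<ℓ)
... | inj₂ i+1≡ℓ = fromℕ< 1≤ℓ , inj₂ (toℕ-fromℕ< 1≤ℓ , i+1≡ℓ)

prev : ∀ {ℓ} → 1 ≤ ℓ → (i : Fin ℓ) → ∃ λ (j : Fin ℓ) → Next ℓ (toℕ j) (toℕ i)
prev {ℓ} 1≤ℓ i with toℕ i in eq
... | suc j = fromℕ< j<ℓ , inj₁ (cong suc (sym (toℕ-fromℕ< j<ℓ)))
  where
  j<ℓ : j < ℓ
  j<ℓ = <-trans (n<1+n j) (subst (_< ℓ) eq (toℕ<n i))
... | zero = fromℕ< ℓ-1<ℓ , inj₂ (refl , trans (cong suc (toℕ-fromℕ< ℓ-1<ℓ)) (m+[n∸m]≡n 1≤ℓ))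
  where
  ℓ-1<ℓ : ℓ ∸ 1 < ℓ
  ℓ-1<ℓ = ≤-reflexive (m+[n∸m]≡n 1≤ℓ)

-- The connectives follow `rawAdjℕ` clause by clause, so that the decision procedure below computes
-- to that boolean.
Joined : (ℓ i p j q : ℕ) → Set
Joined ℓ i p j q =
  (p ≢ q × i ≡ j × ¬ ((p ≡ 0 × q ≡ 1) ⊎ (p ≡ 1 × q ≡ 0)))
  ⊎ ((q ≡ 0 × p ≡ 1 × Next ℓ i j) ⊎ (p ≡ 0 × q ≡ 1 × Next ℓ j i))

joined? : ∀ ℓ i p j q → Dec (Joined ℓ i p j q)
joined? ℓ i p j q =
  (¬? (p ≟ q) ×-dec ((i ≟ j) ×-dec ¬? (((p ≟ 0) ×-dec (q ≟ 1)) ⊎-dec ((p ≟ 1) ×-dec (q ≟ 0)))))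
  ⊎-dec (((q ≟ 0) ×-dec ((p ≟ 1) ×-dec next? ℓ i j)) ⊎-dec ((p ≟ 0) ×-dec ((q ≟ 1) ×-dec next? ℓ j i)))

Joined-sym : ∀ {ℓ i p j q} → Joined ℓ i p j q → Joined ℓ j q i p
Joined-sym (inj₁ (p≢q , i≡j , ¬01)) = inj₁ (p≢q ∘ sym , sym i≡j ,
  λ { (inj₁ (q≡0 , p≡1)) → ¬01 (inj₂ (p≡1 , q≡0)) ; (inj₂ (q≡1 , p≡0)) → ¬01 (inj₁ (p≡0 , q≡1)) })
Joined-sym (inj₂ (inj₁ (q≡0 , p≡1 , next))) = inj₂ (inj₂ (q≡0 , p≡1 , next))
Joined-sym (inj₂ (inj₂ (p≡0 , q≡1 , next))) = inj₂ (inj₁ (p≡0 , q≡1 , next))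

Label : (k ℓ : ℕ) → Set
Label k ℓ = Fin ℓ × Fin (suc k)

_∼_ : ∀ {k ℓ} → Label k ℓ → Label k ℓ → Set
_∼_ {k} {ℓ} (i , p) (j , q) = Joined ℓ (toℕ i) (toℕ p) (toℕ j) (toℕ q)

does-true⇒ : ∀ {P : Set} (d : Dec P) → does d ≡ true → P
does-true⇒ (yes p) _ = p

⇒does-true : ∀ {P : Set} (d : Dec P) → P → does d ≡ true
⇒does-true (yes _) _ = refl
⇒does-true (no ¬p) p = contradiction p ¬p

label : ∀ k ℓ → Fin (ℓ * suc k) → Label k ℓ
label k ℓ = remQuot {ℓ} (suc k)

joined-either? : ∀ {k ℓ} (a b : Label k ℓ) → Dec (a ∼ b ⊎ b ∼ a)
joined-either? {k} {ℓ} (i , p) (j , q) =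
  joined? ℓ (toℕ i) (toℕ p) (toℕ j) (toℕ q) ⊎-dec joined? ℓ (toℕ j) (toℕ q) (toℕ i) (toℕ p)

-- The adjacency of G[ k , ℓ ] is definitionally the boolean of joined-either?.
Gkl-adj⇒∼ : ∀ k ℓ x y → adj G[ k , ℓ ] x y ≡ true → label k ℓ x ∼ label k ℓ y
Gkl-adj⇒∼ k ℓ x y xy = [ id , Joined-sym ]′ (does-true⇒ (joined-either? (label k ℓ x) (label k ℓ y)) xy)

∼⇒Gkl-adj : ∀ k ℓ x y → label k ℓ x ∼ label k ℓ y → adj G[ k , ℓ ] x y ≡ true
∼⇒Gkl-adj k ℓ x y x∼y = ⇒does-true (joined-either? (label k ℓ x) (label k ℓ y)) (inj₁ x∼y)

iff⇒≡ : ∀ {a b : Bool} → (a ≡ true → b ≡ true) → (b ≡ true → a ≡ true) → a ≡ b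
iff⇒≡ {true}  {b}     f g = sym (f refl)
iff⇒≡ {false} {false} f g = refl
iff⇒≡ {false} {true}  f g = g refl

least : ∀ {P : ℕ → Set} → (∀ m → Dec (P m)) → ∀ m → P m → ∃ λ m → P m × ∀ {i} → i < m → ¬ P i
least {P} P? = <-rec _ λ m rec Pm → case m rec Pm
  where
  case : ∀ m → (∀ {i} → i < m → P i → ∃ λ m → P m × ∀ {i} → i < m → ¬ P i) → P m → ∃ λ m → P m × ∀ {i} → i < m → ¬ P i
  case m rec Pm with anyUpTo? P? m
  ... | yes (i , i<m , Pi) = rec i<m Pi
  ... | no none            = m , Pm , λ i<m Pi → none (_ , i<m , Pi)

-- The cyclic arrangement of the copies, and the isomorphism with G(k, ℓ).

module Ring {n k₁ : ℕ} (G : Graph n) (regular : Regular (suc k₁) G) (3≤k : 3 ≤ suc k₁)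
  (connected : Connected G) (u₀ : Fin n)
  (center-near : ∀ u → ∃ λ v → (u ≡ v ⊎ Counting.Adj G u v) × Counting.D G v ≡ 2) where
  open RegularCounting G (suc k₁) regular
  open Blocks G (suc k₁) regular 3≤k center-near

  k : ℕ
  k = suc k₁

  opaque
    mate-out : ∀ x → ∃ λ y → ∃ λ x′ → End x → EndData x y x′
    mate-out x with center? x
    -- Default values at centers, where `mate` and `out` carry no information.
    ... | yes Cx = x , x , λ Ex → contradiction Cx Ex
    ... | no Ex  = let y , x′ , d = end-data Ex in y , x′ , λ _ → d

  mate out : Fin n → Fin n
  mate x = proj₁ (mate-out x)
  out x = proj₁ (proj₂ (mate-out x))

  module E {x} (Ex : End x) = EndData (proj₂ (proj₂ (mate-out x)) Ex)

  end₀ : ∃ End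
  end₀ = let v , _ , Cv = center-near u₀ ; x , _ , b = block Cv in x , Block.endx b

  mate-mate : ∀ {x} → End x → mate (mate x) ≡ x
  mate-mate {x} Ex = [ id , (λ eq → contradiction (sym eq) (proj₁ (E.mate-far Ey))) ]′
    (E.ends Ex (E.center-C Ex) (E.center-adj Ex) (E.mate-to Ey (E.center-C Ex) (E.mate-to Ex (E.center-C Ex) (E.center-adj Ex))) (E.mate-end Ey))
    where
    Ey : End (mate x)
    Ey = E.mate-end Ex

  out-out : ∀ {x} → End x → out (out x) ≡ x
  out-out Ex = sym (E.out-unique (E.out-end Ex) (Adj-sym (E.out-adj Ex)) Ex)

  σ : Fin n → Fin n
  σ x = out (mate x)

  σ-end : ∀ {x} → End x → End (σ x)
  σ-end Ex = E.out-end (E.mate-end Ex)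

  out-σ : ∀ {x} → End x → out (σ x) ≡ mate x
  out-σ Ex = out-out (E.mate-end Ex)

  σ-injective : ∀ {x y} → End x → End y → σ x ≡ σ y → x ≡ y
  σ-injective {x} {y} Ex Ey eq = begin
    x              ≡⟨ mate-mate Ex ⟨
    mate (mate x)  ≡⟨ cong mate (trans (sym (out-σ Ex)) (trans (cong out eq) (out-σ Ey))) ⟩
    mate (mate y)  ≡⟨ mate-mate Ey ⟩
    y              ∎
    where open ≡-Reasoning

  s : ℕ → Fin n
  s zero    = proj₁ end₀
  s (suc i) = σ (s i)

  s-end : ∀ i → End (s i)
  s-end zero    = proj₂ end₀
  s-end (suc i) = σ-end (s-end i)

  -- Injectivity of `σ` removes the first i steps, so any repetition in the sequence is already a
  -- return to its start.
  s-cancel : ∀ i d → s i ≡ s (i + d) → s 0 ≡ s d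
  s-cancel zero    d eq = eq
  s-cancel (suc i) d eq = s-cancel i d (σ-injective (s-end i) (s-end (i + d)) eq)

  -- σ followed by mate is an involution, so s (d + m) ≡ mate (s m) can be moved towards the middle
  -- of the interval, where it contradicts that mate or out has no fixed point.
  s≢mate : ∀ d m → s (d + m) ≢ mate (s m)
  s≢mate zero          m eq = proj₁ (E.mate-far (s-end m)) eq
  s≢mate (suc zero)    m eq = Adj⇒≢ (E.out-adj (E.mate-end (s-end m))) (sym eq)
  s≢mate (suc (suc d)) m eq = s≢mate d (suc m) (begin
    s (d + suc m)                  ≡⟨ cong s (+-suc d m) ⟩
    s (suc d + m)                  ≡⟨ mate-mate (s-end (suc d + m)) ⟨
    mate (mate (s (suc d + m)))    ≡⟨ cong mate (trans (sym (out-σ (s-end (suc d + m)))) (cong out eq)) ⟩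
    mate (s (suc m))               ∎)
    where open ≡-Reasoning

  s≢mate-s : ∀ i j → s i ≢ mate (s j)
  s≢mate-s i j eq with ≤-total j i
  ... | inj₁ j≤i = s≢mate (i ∸ j) j (trans (cong s (m∸n+n≡m j≤i)) eq)
  ... | inj₂ i≤j = s≢mate (j ∸ i) i (trans (cong s (m∸n+n≡m i≤j)) (trans (sym (mate-mate (s-end j))) (cong mate (sym eq))))

  opaque
    -- Pigeonhole on n+1 terms yields a return. Taking the least one makes the ends `s 0`, ...,
    -- `s (ℓ − 1)` distinct, so that each copy is listed once.
    period : ∃ λ ℓ → (1 ≤ ℓ × s 0 ≡ s ℓ) × ∀ {d} → d < ℓ → ¬ (1 ≤ d × s 0 ≡ s d)
    period with i , j , i<j , eq ← pigeonhole (n<1+n n) (s ∘ toℕ) =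
      least (λ d → (1 ≤? d) ×-dec (s 0 ≟F s d)) (toℕ j ∸ toℕ i)
        (m<n⇒0<n∸m i<j , s-cancel (toℕ i) _ (trans eq (cong s (sym (m+[n∸m]≡n (<⇒≤ i<j))))))

  ℓ : ℕ
  ℓ = proj₁ period

  1≤ℓ : 1 ≤ ℓ
  1≤ℓ = proj₁ (proj₁ (proj₂ period))

  s0≡sℓ : s 0 ≡ s ℓ
  s0≡sℓ = proj₂ (proj₁ (proj₂ period))

  s-injective-≤ : ∀ {i j} → i ≤ j → j < ℓ → s i ≡ s j → i ≡ j
  s-injective-≤ {i} {j} i≤j j<ℓ eq with j ∸ i in d≡
  ... | zero  = ≤-antisym i≤j (m∸n≡0⇒m≤n d≡)
  ... | suc d = contradiction (s≤s z≤n , s-cancel i (suc d) (trans eq (cong s (trans (sym (m+[n∸m]≡n i≤j)) (cong (i +_) d≡)))))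
    (proj₂ (proj₂ period) (≤-<-trans (≤-trans (≤-reflexive (sym d≡)) (m∸n≤m j i)) j<ℓ))

  s-injective : ∀ {i j : Fin ℓ} → s (toℕ i) ≡ s (toℕ j) → i ≡ j
  s-injective {i} {j} eq with ≤-total (toℕ i) (toℕ j)
  ... | inj₁ i≤j = toℕ-injective (s-injective-≤ i≤j (toℕ<n j) eq)
  ... | inj₂ j≤i = toℕ-injective (sym (s-injective-≤ j≤i (toℕ<n i) (sym eq)))

  Next⇒σ : ∀ {i j} → Next ℓ i j → s j ≡ σ (s i)
  Next⇒σ (inj₁ refl)          = refl
  Next⇒σ (inj₂ (refl , i+1≡ℓ)) = trans s0≡sℓ (cong s (sym i+1≡ℓ))

  centerNbr : Fin n → Fin n → Bool
  centerNbr x z = adj G x z ∧ does (center? z)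

  centerNbr⇒ : ∀ {x z} → centerNbr x z ≡ true → Adj x z × Center z
  centerNbr⇒ {x} {z} h with adj G x z | center? z
  ... | true | yes Cz = refl , Cz

  ⇒centerNbr : ∀ {x z} → Adj x z → Center z → centerNbr x z ≡ true
  ⇒centerNbr xz Cz = cong₂ _∧_ xz (⇒does-true (center? _) Cz)

  -- Among the k neighbours of an end, `out x` is the only one that is not a center.
  count-centerNbr : ∀ {x} → End x → sum (λ z → b2n (centerNbr x z)) ≡ k₁
  count-centerNbr {x} Ex = suc-injective (begin
    1 + sum (λ z → b2n (centerNbr x z))      ≡⟨ +-comm 1 _ ⟩
    sum (λ z → b2n (centerNbr x z)) + 1      ≡⟨ cong₂ _+_ refl (trans (sum-single endNbr (out x) off-out) at-out) ⟨
    sum (λ z → b2n (centerNbr x z)) + sum endNbr  ≡⟨ ∑-distrib-+ _ _ ⟨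
    sum (λ z → b2n (centerNbr x z) + endNbr z)    ≡⟨ sum-cong-≗ pointwise ⟩
    sum (A x)                                ≡⟨ sum-A x ⟩
    k                                        ∎)
    where
    open ≡-Reasoning
    endNbr : Fin n → ℕ
    endNbr z = b2n (adj G x z ∧ not (does (center? z)))
    pointwise : ∀ z → b2n (centerNbr x z) + endNbr z ≡ A x z
    pointwise z with adj G x z | center? z
    ... | true  | yes _ = refl
    ... | true  | no _  = refl
    ... | false | _     = refl
    at-out : endNbr (out x) ≡ 1
    at-out with center? (out x)
    ... | yes Cx′ = contradiction Cx′ (E.out-end Ex)
    ... | no _ rewrite E.out-adj Ex = refl
    off-out : ∀ z → z ≢ out x → endNbr z ≡ 0
    off-out z z≢ with adj G x z in xz | center? z
    ... | true  | yes _ = refl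
    ... | true  | no Ez = contradiction (E.out-unique Ex xz Ez) z≢
    ... | false | _     = refl

  opaque
    enum : ∀ i → Enumeration (centerNbr (s i)) k₁
    enum i = enumerate (centerNbr (s i)) (count-centerNbr (s-end i))

  inner : ∀ i → Fin k₁ → Fin n
  inner i = Enumeration.elem (enum i)

  inner-adj : ∀ i p → Adj (s i) (inner i p)
  inner-adj i p = proj₁ (centerNbr⇒ (Enumeration.sound (enum i) p))

  inner-center : ∀ i p → Center (inner i p)
  inner-center i p = proj₂ (centerNbr⇒ {s i} (Enumeration.sound (enum i) p))

  inner-complete : ∀ i {z} → Adj (s i) z → Center z → ∃ λ p → inner i p ≡ z
  inner-complete i xz Cz = Enumeration.complete (enum i) (⇒centerNbr xz Cz)

  -- Positions 0 and 1 receive the non-adjacent ends of copy i. The order matters: `s (suc i)` is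
  -- `out (mate (s i))`, so position 1 is joined to position 0 of the following copy, as in G(k, ℓ).
  vertex : Label k ℓ → Fin n
  vertex (i , zero)        = s (toℕ i)
  vertex (i , suc zero)    = mate (s (toℕ i))
  vertex (i , suc (suc p)) = inner (toℕ i) p

  vertex-injective : ∀ {a b} → vertex a ≡ vertex b → a ≡ b
  vertex-injective {i , zero}        {j , zero}        eq = cong (_, zero) (s-injective eq)
  vertex-injective {i , zero}        {j , suc zero}    eq = contradiction eq (s≢mate-s (toℕ i) (toℕ j))
  vertex-injective {i , suc zero}    {j , zero}        eq = contradiction (sym eq) (s≢mate-s (toℕ j) (toℕ i))
  vertex-injective {i , suc zero}    {j , suc zero}    eq = cong (_, suc zero) (s-injective
    (trans (sym (mate-mate (s-end (toℕ i)))) (trans (cong mate eq) (mate-mate (s-end (toℕ j))))))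
  vertex-injective {i , zero}        {j , suc (suc q)} eq =
    contradiction (subst Center (sym eq) (inner-center (toℕ j) q)) (s-end (toℕ i))
  vertex-injective {i , suc (suc p)} {j , zero}        eq =
    contradiction (subst Center eq (inner-center (toℕ i) p)) (s-end (toℕ j))
  vertex-injective {i , suc zero}    {j , suc (suc q)} eq =
    contradiction (subst Center (sym eq) (inner-center (toℕ j) q)) (E.mate-end (s-end (toℕ i)))
  vertex-injective {i , suc (suc p)} {j , suc zero}    eq =
    contradiction (subst Center eq (inner-center (toℕ i) p)) (E.mate-end (s-end (toℕ j)))
  -- A shared center has both `s i` and `s j` among its two ends, which are `s i` and its mate.
  vertex-injective {i , suc (suc p)} {j , suc (suc q)} eq
    with E.ends (s-end (toℕ i)) (inner-center (toℕ i) p) (Adj-sym (inner-adj (toℕ i) p))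
           (subst (λ c → Adj c (s (toℕ j))) (sym eq) (Adj-sym (inner-adj (toℕ j) q))) (s-end (toℕ j))
  ... | inj₂ sj≡mate = contradiction sj≡mate (s≢mate-s (toℕ j) (toℕ i))
  ... | inj₁ sj≡si with refl ← s-injective {j} {i} sj≡si =
    cong (λ p → i , suc (suc p)) (Enumeration.injective (enum (toℕ i)) eq)

  inner-inner : ∀ i {p q} → p ≢ q → Adj (inner i p) (inner i q)
  inner-inner i {p} {q} p≢q
    with centers-at-end (s-end i) (inner-center i p) (inner-center i q) (inner-adj i p) (inner-adj i q)
  ... | inj₁ eq = contradiction (sym (Enumeration.injective (enum i) eq)) p≢q
  ... | inj₂ pq = pq

  ∼⇒Adj : ∀ a b → a ∼ b → Adj (vertex a) (vertex b)
  ∼⇒Adj (i , zero)        (j , zero)        (inj₁ (p≢q , _))       = contradiction refl p≢q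
  ∼⇒Adj (i , zero)        (j , suc zero)    (inj₁ (_ , _ , ¬01))   = contradiction (inj₁ (refl , refl)) ¬01
  ∼⇒Adj (i , suc zero)    (j , zero)        (inj₁ (_ , _ , ¬01))   = contradiction (inj₂ (refl , refl)) ¬01
  ∼⇒Adj (i , suc zero)    (j , suc zero)    (inj₁ (p≢q , _))       = contradiction refl p≢q
  ∼⇒Adj (i , zero)        (j , suc (suc q)) (inj₁ (_ , i≡j , _))
    rewrite i≡j = inner-adj (toℕ j) q
  ∼⇒Adj (i , suc (suc p)) (j , zero)        (inj₁ (_ , i≡j , _))
    rewrite i≡j = Adj-sym (inner-adj (toℕ j) p)
  ∼⇒Adj (i , suc zero)    (j , suc (suc q)) (inj₁ (_ , i≡j , _))
    rewrite i≡j = Adj-sym (E.mate-to (s-end (toℕ j)) (inner-center (toℕ j) q) (Adj-sym (inner-adj (toℕ j) q)))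
  ∼⇒Adj (i , suc (suc p)) (j , suc zero)    (inj₁ (_ , i≡j , _))
    rewrite i≡j = E.mate-to (s-end (toℕ j)) (inner-center (toℕ j) p) (Adj-sym (inner-adj (toℕ j) p))
  ∼⇒Adj (i , suc (suc p)) (j , suc (suc q)) (inj₁ (p≢q , i≡j , _))
    rewrite i≡j = inner-inner (toℕ j) (λ { refl → p≢q refl })
  ∼⇒Adj (i , p) (j , q) (inj₂ (inj₁ (q≡0 , p≡1 , nxt)))
    with refl ← toℕ-injective {j = suc zero} p≡1 | refl ← toℕ-injective {j = zero} q≡0
    rewrite Next⇒σ nxt = E.out-adj (E.mate-end (s-end (toℕ i)))
  ∼⇒Adj (i , p) (j , q) (inj₂ (inj₂ (p≡0 , q≡1 , nxt)))
    with refl ← toℕ-injective {j = zero} p≡0 | refl ← toℕ-injective {j = suc zero} q≡1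
    rewrite Next⇒σ nxt = Adj-sym (E.out-adj (E.mate-end (s-end (toℕ j))))

  -- Besides reflecting adjacency, this shows that the labelled vertices are closed under taking
  -- neighbours, from which connectivity gives surjectivity in `labelOf`.
  Adj⇒∼ : ∀ a {z} → Adj (vertex a) z → ∃ λ b → vertex b ≡ z × a ∼ b
  Adj⇒∼ (i , zero) {z} az with center? z
  ... | yes Cz = let q , eq = inner-complete (toℕ i) az Cz in
    (i , suc (suc q)) , eq , inj₁ ((λ ()) , refl , λ { (inj₁ ()) ; (inj₂ (() , _)) })
  ... | no Ez = let j , nxt = prev 1≤ℓ i in
    (j , suc zero) , trans (sym (trans (cong out (Next⇒σ nxt)) (out-σ (s-end (toℕ j))))) (sym (E.out-unique (s-end (toℕ i)) az Ez)) ,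
    inj₂ (inj₂ (refl , refl , nxt))
  Adj⇒∼ (i , suc zero) {z} az with center? z
  ... | yes Cz = let q , eq = inner-complete (toℕ i) (Adj-sym (E.mate-from (s-end (toℕ i)) Cz (Adj-sym az))) Cz in
    (i , suc (suc q)) , eq , inj₁ ((λ ()) , refl , λ { (inj₁ (() , _)) ; (inj₂ (_ , ())) })
  ... | no Ez = let j , nxt = next 1≤ℓ i in
    (j , zero) , trans (Next⇒σ nxt) (sym (E.out-unique (E.mate-end (s-end (toℕ i))) az Ez)) ,
    inj₂ (inj₁ (refl , refl , nxt))
  Adj⇒∼ (i , suc (suc p)) {z} az with center? z
  Adj⇒∼ (i , suc (suc p)) {z} az | no Ez
    with E.ends (s-end (toℕ i)) (inner-center (toℕ i) p) (Adj-sym (inner-adj (toℕ i) p)) az Ez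
  ... | inj₁ z≡s = (i , zero) , sym z≡s , inj₁ ((λ ()) , refl , λ { (inj₁ (() , _)) ; (inj₂ (() , _)) })
  ... | inj₂ z≡m = (i , suc zero) , sym z≡m , inj₁ ((λ ()) , refl , λ { (inj₁ (() , _)) ; (inj₂ (() , _)) })
  Adj⇒∼ (i , suc (suc p)) {z} az | yes Cz
    with proj₂ (adjacent-centers (inner-center (toℕ i) p) Cz az) (Adj-sym (inner-adj (toℕ i) p))
  ... | inj₁ s≡z = contradiction (subst Center (sym s≡z) Cz) (s-end (toℕ i))
  ... | inj₂ zs with q , eq ← inner-complete (toℕ i) (Adj-sym zs) Cz =
    (i , suc (suc q)) , eq , inj₁ (p≢q , refl , λ { (inj₁ (() , _)) ; (inj₂ (() , _)) })
    where
    p≢q : suc (suc (toℕ p)) ≢ suc (suc (toℕ q))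
    p≢q p≡q = Adj⇒≢ az (trans (cong (inner (toℕ i)) (toℕ-injective (suc-injective (suc-injective p≡q)))) eq)

  opaque
    labelOf : ∀ z → ∃ λ a → vertex a ≡ z
    labelOf z = go (fromℕ< 1≤ℓ , zero) (connected _ z)
      where
      go : ∀ a {z} → Reach G (vertex a) z → ∃ λ b → vertex b ≡ z
      go a here = a , refl
      go a (step az path) with b , refl , _ ← Adj⇒∼ a az = go b path

  position↔ : Fin n ↔ Fin (ℓ * suc k)
  position↔ = mk↔ₛ′ to from to-from from-to
    where
    to : Fin n → Fin (ℓ * suc k)
    to z = let (i , p) , _ = labelOf z in combine i p
    from : Fin (ℓ * suc k) → Fin n
    from x = vertex (label k ℓ x)
    from-to : ∀ z → from (to z) ≡ z
    from-to z = let (i , p) , eq = labelOf z in trans (cong vertex (remQuot-combine i p)) eq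
    to-from : ∀ x → to (from x) ≡ x
    to-from x = trans (cong (λ a → combine (proj₁ a) (proj₂ a)) (vertex-injective (proj₂ (labelOf (from x)))))
      (combine-remQuot {ℓ} (suc k) x)

  isomorphic : G ≅ G[ k , ℓ ]
  isomorphic = position↔ , λ u v → iff⇒≡ (forth u v) (back u v)
    where
    open import Function.Bundles using (Inverse)
    lab : ∀ z → label k ℓ (Inverse.to position↔ z) ≡ proj₁ (labelOf z)
    lab z = let (i , p) , _ = labelOf z in remQuot-combine i p
    forth : ∀ u v → Adj u v → adj G[ k , ℓ ] (Inverse.to position↔ u) (Inverse.to position↔ v) ≡ true
    forth u v uv
      with b , eq , a∼b ← Adj⇒∼ (proj₁ (labelOf u)) {v} (subst (λ u → Adj u v) (sym (proj₂ (labelOf u))) uv)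
      = ∼⇒Gkl-adj k ℓ _ _ (subst₂ _∼_ (sym (lab u)) (trans (vertex-injective (trans eq (sym (proj₂ (labelOf v))))) (sym (lab v))) a∼b)
    back : ∀ u v → adj G[ k , ℓ ] (Inverse.to position↔ u) (Inverse.to position↔ v) ≡ true → Adj u v
    back u v uv = subst₂ Adj (proj₂ (labelOf u)) (proj₂ (labelOf v))
      (∼⇒Adj _ _ (subst₂ _∼_ (lab u) (lab v) (Gkl-adj⇒∼ k ℓ (Inverse.to position↔ u) (Inverse.to position↔ v) uv)))

  G≅Gkl : Σ ℕ λ ℓ → (n ≡ ℓ * suc k) × (G ≅ G[ k , ℓ ])
  G≅Gkl = ℓ , ↔⇒≡ position↔ , isomorphic

-- The converse: G(k, ℓ) attains the bound.

Next-injective : ∀ {ℓ i j i′} → Next ℓ i j → Next ℓ i′ j → i ≡ i′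
Next-injective (inj₁ refl)       (inj₁ j≡)        = suc-injective j≡
Next-injective (inj₁ refl)       (inj₂ (() , _))
Next-injective (inj₂ (refl , _)) (inj₁ ())
Next-injective (inj₂ (_ , refl)) (inj₂ (_ , i′+1≡)) = suc-injective (sym i′+1≡)

Next-functional : ∀ {ℓ i j j′} → j < ℓ → j′ < ℓ → Next ℓ i j → Next ℓ i j′ → j ≡ j′
Next-functional _   _    (inj₁ refl)          (inj₁ refl)          = refl
Next-functional j<ℓ _    (inj₁ refl)          (inj₂ (_ , refl))    = contradiction j<ℓ (<-irrefl refl)
Next-functional _   j′<ℓ (inj₂ (_ , refl))    (inj₁ refl)          = contradiction j′<ℓ (<-irrefl refl)
Next-functional _   _    (inj₂ (refl , _))    (inj₂ (refl , _))    = refl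

-- With a single copy the connecting edge would restore the removed one; this is what keeps
-- positions 0 and 1 of a copy non-adjacent.
Next-irreflexive : ∀ {ℓ i} → 2 ≤ ℓ → ¬ Next ℓ i i
Next-irreflexive _ (inj₁ i≡1+i) = contradiction (sym i≡1+i) 1+n≢n
Next-irreflexive (s≤s ()) (inj₂ (refl , refl))

module Hub {n : ℕ} (G : Graph n) (k : ℕ) (regular : Regular k G) where
  open RegularCounting G k regular

  -- The row of o has at most k-1 entries, and each of the other k-1 neighbours of v can miss only
  -- o.
  hub-bound : ∀ {v o} → Adj v o → (∀ {a b} → Adj v a → Adj v b → Far a b → a ≡ o ⊎ b ≡ o) → D v + 2 ≤ 2 * k
  hub-bound {v} {o} vo meets = begin
    D v + 2
      ≡⟨ cong (_+ 2) (split o (λ a → A v a * c v a)) ⟩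
    A v o * c v o + (sum (λ a → A o a * (A v a * c v a)) + sum (λ a → F o a * (A v a * c v a))) + 2
      ≤⟨ +-monoˡ-≤ 2 (+-monoʳ-≤ (A v o * c v o) (+-mono-≤ (weighted-mono (A o) (λ a 1≤ → row (Adj⇒≢ (1≤A 1≤) ∘ sym)))
           (weighted-mono (F o) (λ a 1≤ → row (proj₁ (1≤F 1≤) ∘ sym))))) ⟩
    A v o * c v o + others + 2
      ≡⟨ cong (λ t → t * c v o + others + 2) (A≡1 vo) ⟩
    1 * c v o + others + 2
      ≡⟨ ring₁ (c v o) others ⟩
    (1 + c v o) + (1 + others)
      ≤⟨ +-mono-≤ c-bound (≤-reflexive (sym k≡)) ⟩
    k + k
      ≡⟨ cong (k +_) (+-identityʳ k) ⟨
    2 * k ∎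
    where
    open ≤-Reasoning
    others : ℕ
    others = sum (λ a → A o a * (A v a * 1)) + sum (λ a → F o a * (A v a * 1))
    ring₁ : ∀ c d → 1 * c + d + 2 ≡ (1 + c) + (1 + d)
    ring₁ = solve-∀
    k≡ : k ≡ 1 + others
    k≡ = trans (sym (sum-A v)) (trans (sum-cong-≗ λ a → sym (*-identityʳ (A v a)))
      (trans (split o (λ a → A v a * 1)) (cong (λ t → t * 1 + others) (A≡1 vo))))
    c-bound : 1 + c v o ≤ k
    c-bound = begin
      1 + c v o                                        ≤⟨ +-monoʳ-≤ 1 (m≤n+m (c v o) _) ⟩
      1 + (sum (λ z → A o z * A v z) + c v o)          ≡⟨ cong (λ t → t + (sum (λ z → A o z * A v z) + c v o)) (A≡1 vo) ⟨
      A v o + (sum (λ z → A o z * A v z) + c v o)      ≡⟨ degree-split v o ⟨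
      k                                                ∎
    row : ∀ {a} → a ≢ o → A v a * c v a ≤ A v a * 1
    row {a} a≢o with position v a
    ... | same refl rewrite A-refl v = z≤n
    ... | far va rewrite A≡0 va = z≤n
    ... | adjacent va = *-monoʳ-≤ (A v a) (≤-trans (≤-reflexive (sum-single (λ z → A v z * F z a) o only-o)) (A*F≤1 v o o a))
      where
      only-o : ∀ z → z ≢ o → A v z * F z a ≡ 0
      only-o z z≢o = n<1⇒n≡0 (≰⇒> λ 1≤ → let vz , za = 1≤A*F {v} {z} 1≤ in [ z≢o , a≢o ]′ (meets vz va za))

module Converse {n k₁ ℓ : ℕ} (G : Graph n) (regular : Regular (suc k₁) G)
  (n≡ : n ≡ ℓ * suc (suc k₁)) (2≤ℓ : 2 ≤ ℓ) (iso : G ≅ G[ suc k₁ , ℓ ]) where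
  open RegularCounting G (suc k₁) regular
  open Excess G (suc k₁) regular
  open Hub G (suc k₁) regular

  k : ℕ
  k = suc k₁

  f : Fin n ↔ Fin (ℓ * suc k)
  f = proj₁ iso

  lab : Fin n → Label k ℓ
  lab v = label k ℓ (Inverse.to f v)

  blk slot : Fin n → ℕ
  blk v = toℕ (proj₁ (lab v))
  slot v = toℕ (proj₂ (lab v))

  at : Label k ℓ → Fin n
  at (i , p) = Inverse.from f (combine i p)

  lab-at : ∀ a → lab (at a) ≡ a
  lab-at (i , p) = trans (cong (label k ℓ) (Inverse.strictlyInverseˡ f (combine i p))) (remQuot-combine i p)

  at-lab : ∀ v → at (lab v) ≡ v
  at-lab v = trans (cong (Inverse.from f) (combine-remQuot {ℓ} (suc k) (Inverse.to f v))) (Inverse.strictlyInverseʳ f v)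

  same-place : ∀ {u v} → blk u ≡ blk v → slot u ≡ slot v → u ≡ v
  same-place {u} {v} b p = trans (sym (at-lab u))
    (trans (cong at (×-≡,≡→≡ (toℕ-injective b , toℕ-injective p))) (at-lab v))

  Adj⇒∼ : ∀ {u v} → Adj u v → lab u ∼ lab v
  Adj⇒∼ {u} {v} uv = Gkl-adj⇒∼ k ℓ (Inverse.to f u) (Inverse.to f v) (trans (sym (proj₂ iso u v)) uv)

  ∼⇒Adj : ∀ {u v} → lab u ∼ lab v → Adj u v
  ∼⇒Adj {u} {v} u∼v = trans (proj₂ iso u v) (∼⇒Gkl-adj k ℓ (Inverse.to f u) (Inverse.to f v) u∼v)

  Inner : ℕ → Fin n → Set
  Inner i v = blk v ≡ i × slot v ≢ 0 × slot v ≢ 1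

  inner-clique : ∀ {i a b} → Inner i a → blk b ≡ i → ¬ Far a b
  inner-clique {a = a} {b} (a∈i , a≢0 , a≢1) b∈i ab = Adj⇒¬Far (∼⇒Adj {a} {b} (inj₁
    ( (λ p → proj₁ ab (same-place (trans a∈i (sym b∈i)) p)) , trans a∈i (sym b∈i)
    , λ { (inj₁ (a≡0 , _)) → a≢0 a≡0 ; (inj₂ (a≡1 , _)) → a≢1 a≡1 }))) ab

  -- Apart from o, the neighbours of v are inner vertices of its own copy. These form a clique, so
  -- every missing edge of N(v) contains o.
  end-bound : ∀ {v o} → Adj v o → (∀ {a} → Adj v a → a ≡ o ⊎ Inner (blk v) a) → D v + 2 ≤ 2 * k
  end-bound {v} {o} vo nbr = hub-bound vo meets
    where
    meets : ∀ {a b} → Adj v a → Adj v b → Far a b → a ≡ o ⊎ b ≡ o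
    meets va vb ab with nbr va | nbr vb
    ... | inj₁ a≡o | _         = inj₁ a≡o
    ... | inj₂ _   | inj₁ b≡o  = inj₂ b≡o
    ... | inj₂ a∈  | inj₂ b∈   = contradiction ab (inner-clique a∈ (proj₁ b∈))

  at-blk : ∀ i p → blk (at (i , p)) ≡ toℕ i
  at-blk i p = cong (toℕ ∘ proj₁) (lab-at (i , p))

  at-slot : ∀ i p → slot (at (i , p)) ≡ toℕ p
  at-slot i p = cong (toℕ ∘ proj₂) (lab-at (i , p))

  1≤ℓ : 1 ≤ ℓ
  1≤ℓ = ≤-trans (n≤1+n 1) 2≤ℓ

  D-first : ∀ v → slot v ≡ 0 → D v + 2 ≤ 2 * k
  D-first v v≡0 with j , nxt ← prev 1≤ℓ (proj₁ (lab v)) = end-bound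
    (∼⇒Adj {v} {o} (inj₂ (inj₂ (v≡0 , at-slot j (suc zero) , subst (λ b → Next ℓ b (blk v)) (sym (at-blk j _)) nxt)))) nbr
    where
    o : Fin n
    o = at (j , suc zero)
    nbr : ∀ {a} → Adj v a → a ≡ o ⊎ Inner (blk v) a
    nbr {a} va with Adj⇒∼ {v} {a} va
    ... | inj₁ (v≢a , eq , ¬01) = inj₂ (sym eq , (λ a≡0 → v≢a (trans v≡0 (sym a≡0))) , λ a≡1 → ¬01 (inj₁ (v≡0 , a≡1)))
    ... | inj₂ (inj₁ (_ , v≡1 , _)) = contradiction (trans (sym v≡0) v≡1) λ ()
    ... | inj₂ (inj₂ (_ , a≡1 , nxt′)) = inj₁ (same-place
      (trans (Next-injective nxt′ nxt) (sym (at-blk j _))) (trans a≡1 (sym (at-slot j (suc zero)))))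

  D-second : ∀ v → slot v ≡ 1 → D v + 2 ≤ 2 * k
  D-second v v≡1 with j , nxt ← next 1≤ℓ (proj₁ (lab v)) = end-bound
    (∼⇒Adj {v} {o} (inj₂ (inj₁ (at-slot j zero , v≡1 , subst (Next ℓ (blk v)) (sym (at-blk j _)) nxt)))) nbr
    where
    o : Fin n
    o = at (j , zero)
    nbr : ∀ {a} → Adj v a → a ≡ o ⊎ Inner (blk v) a
    nbr {a} va with Adj⇒∼ {v} {a} va
    ... | inj₁ (v≢a , eq , ¬01) = inj₂ (sym eq , (λ a≡0 → ¬01 (inj₂ (v≡1 , a≡0))) , λ a≡1 → v≢a (trans v≡1 (sym a≡1)))
    ... | inj₂ (inj₁ (a≡0 , _ , nxt′)) = inj₁ (same-place
      (trans (Next-functional (toℕ<n (proj₁ (lab a))) (toℕ<n j) nxt′ nxt) (sym (at-blk j _))) (trans a≡0 (sym (at-slot j zero))))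
    ... | inj₂ (inj₂ (v≡0 , _ , _)) = contradiction (trans (sym v≡0) v≡1) λ ()

  D-inner : ∀ v → slot v ≢ 0 → slot v ≢ 1 → D v ≡ 2
  D-inner v v≢0 v≢1 = unique-missing⇒D≡2 {v} {x} {y} vx vy xy none
    where
    i : Fin ℓ
    i = proj₁ (lab v)
    x y : Fin n
    x = at (i , zero)
    y = at (i , suc zero)
    not01 : ∀ {q} → ¬ ((slot v ≡ 0 × q ≡ 1) ⊎ (slot v ≡ 1 × q ≡ 0))
    not01 (inj₁ (v≡0 , _)) = v≢0 v≡0
    not01 (inj₂ (v≡1 , _)) = v≢1 v≡1
    vx : Adj v x
    vx = ∼⇒Adj {v} {x} (inj₁ ((λ e → v≢0 (trans e (at-slot i zero))) , sym (at-blk i zero) , not01))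
    vy : Adj v y
    vy = ∼⇒Adj {v} {y} (inj₁ ((λ e → v≢1 (trans e (at-slot i (suc zero)))) , sym (at-blk i (suc zero)) , not01))
    xy : Far x y
    xy with position x y
    ... | far xy = xy
    ... | same x≡y = contradiction (trans (sym (at-slot i zero)) (trans (cong slot x≡y) (at-slot i (suc zero)))) λ ()
    ... | adjacent xy with Adj⇒∼ {x} {y} xy
    ... | inj₁ (_ , _ , ¬01) = contradiction (inj₁ (at-slot i zero , at-slot i (suc zero))) ¬01
    ... | inj₂ (inj₁ (y≡0 , _ , _)) = contradiction (trans (sym (at-slot i (suc zero))) y≡0) λ ()
    ... | inj₂ (inj₂ (_ , _ , nxt)) = contradiction
      (subst₂ (Next ℓ) (at-blk i (suc zero)) (at-blk i zero) nxt) (Next-irreflexive 2≤ℓ)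
    same-block : ∀ {a} → Adj v a → blk a ≡ toℕ i
    same-block {a} va with Adj⇒∼ {v} {a} va
    ... | inj₁ (_ , eq , _)          = sym eq
    ... | inj₂ (inj₁ (_ , v≡1 , _))  = contradiction v≡1 v≢1
    ... | inj₂ (inj₂ (v≡0 , _ , _))  = contradiction v≡0 v≢0
    none : ∀ w → Adj v w → w ≢ x → w ≢ y → ¬ 1 ≤ c v w
    none w vw w≢x w≢y 1≤c with z , vz , zw ← 1≤c⇒far-pair 1≤c = inner-clique
      ( same-block vw
      , (λ w≡0 → w≢x (same-place (trans (same-block vw) (sym (at-blk i zero))) (trans w≡0 (sym (at-slot i zero)))))
      , (λ w≡1 → w≢y (same-place (trans (same-block vw) (sym (at-blk i (suc zero)))) (trans w≡1 (sym (at-slot i (suc zero)))))))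
      (same-block vz) (Far-sym zw)

  -- Bounds for D + 2 by position. Their total over a copy is 8k - 4, that is 6(k-1) plus 2 for each
  -- of the k+1 vertices.
  weight : Fin (suc k) → ℕ
  weight zero          = 2 * k
  weight (suc zero)    = 2 * k
  weight (suc (suc _)) = 4

  D≤weight : ∀ v → D v + 2 ≤ weight (proj₂ (lab v))
  D≤weight v with proj₂ (lab v) in eq
  ... | zero          = D-first v (cong toℕ eq)
  ... | suc zero      = D-second v (cong toℕ eq)
  ... | suc (suc p)   = ≤-reflexive (cong (_+ 2) (D-inner v
    (λ v≡0 → contradiction (trans (sym (cong toℕ eq)) v≡0) λ ())
    (λ v≡1 → contradiction (trans (sym (cong toℕ eq)) v≡1) λ ())))

  sum-weight : sum weight ≡ 2 * k + (2 * k + k₁ * 4)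
  sum-weight = trans (sum-suc weight) (cong (2 * k +_) (trans (sum-suc (weight ∘ suc)) (cong (2 * k +_) (sum-const k₁ 4))))

  total-upper : sum D + n * 2 ≤ ℓ * (2 * k + (2 * k + k₁ * 4))
  total-upper = begin
    sum D + n * 2                                                ≡⟨ cong (sum D +_) (sum-const n 2) ⟨
    sum D + sum {n} (λ _ → 2)                                    ≡⟨ ∑-distrib-+ D (λ _ → 2) ⟨
    sum (λ v → D v + 2)                                          ≤⟨ sum-mono D≤weight ⟩
    sum (λ v → weight (proj₂ (lab v)))                           ≡⟨ sum-permute (λ x → weight (proj₂ (label k ℓ x))) f ⟨
    sum (λ x → weight (proj₂ (label k ℓ x)))                     ≡⟨ sum-remainder ℓ (suc k) weight ⟩
    ℓ * sum weight                                               ≡⟨ cong (ℓ *_) sum-weight ⟩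
    ℓ * (2 * k + (2 * k + k₁ * 4))                               ∎
    where open ≤-Reasoning

  tight : suc k * sum D + n * 6 ≤ n * (6 * k)
  tight = +-cancelʳ-≤ (suc k * (n * 2)) _ _ (begin
    suc k * sum D + n * 6 + suc k * (n * 2)                  ≡⟨ ring₁ (suc k) (sum D) (n * 6) (n * 2) ⟩
    suc k * (sum D + n * 2) + n * 6                          ≤⟨ +-monoˡ-≤ (n * 6) (*-monoʳ-≤ (suc k) total-upper) ⟩
    suc k * (ℓ * (2 * k + (2 * k + k₁ * 4))) + n * 6         ≡⟨ cong (λ n → suc k * (ℓ * (2 * k + (2 * k + k₁ * 4))) + n * 6) n≡ ⟩
    suc k * (ℓ * (2 * k + (2 * k + k₁ * 4))) + ℓ * suc k * 6 ≡⟨ ring₂ ℓ k₁ ⟩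
    ℓ * suc k * (6 * k) + suc k * (ℓ * suc k * 2)            ≡⟨ cong (λ n → n * (6 * k) + suc k * (n * 2)) n≡ ⟨
    n * (6 * k) + suc k * (n * 2)                            ∎)
    where
    open ≤-Reasoning
    ring₁ : ∀ k s a b → k * s + a + k * b ≡ k * (s + b) + a
    ring₁ = solve-∀
    ring₂ : ∀ ℓ k → (2 + k) * (ℓ * (2 * (1 + k) + (2 * (1 + k) + k * 4))) + ℓ * (2 + k) * 6
      ≡ ℓ * (2 + k) * (6 * (1 + k)) + (2 + k) * (ℓ * (2 + k) * 2)
    ring₂ = solve-∀

-- Arithmetic of fractions.

toℚᵘ-/ : ∀ a d → toℚᵘ (pos a / suc d) ≃ mkℚᵘ (pos a) d
toℚᵘ-/ a d = ℚ.toℚᵘ-fromℚᵘ (mkℚᵘ (pos a) d)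

/-≡ : ∀ a b d e .{{_ : NonZero d}} .{{_ : NonZero e}} → a * e ≡ b * d → pos a / d ≡ pos b / e
/-≡ a b (suc d) (suc e) eq = ℚ.fromℚᵘ-cong {mkℚᵘ (pos a) d} {mkℚᵘ (pos b) e}
  (*≡* (trans (sym (ℤ.pos-* a (suc e))) (trans (cong pos eq) (ℤ.pos-* b (suc d)))))

/-+ : ∀ a b d e .{{_ : NonZero d}} .{{_ : NonZero e}} .{{_ : NonZero (d * e)}} →
  (pos a / d) +ℚ (pos b / e) ≡ pos (a * e + b * d) / (d * e)
/-+ a b (suc d) (suc e) = ℚ.toℚᵘ-injective (begin-equality
  toℚᵘ ((pos a / suc d) +ℚ (pos b / suc e))             ≃⟨ ℚ.toℚᵘ-homo-+ (pos a / suc d) (pos b / suc e) ⟩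
  toℚᵘ (pos a / suc d) ℚᵘ.+ toℚᵘ (pos b / suc e)        ≃⟨ ℚᵘ.+-cong (toℚᵘ-/ a d) (toℚᵘ-/ b e) ⟩
  mkℚᵘ (pos a ℤ.* pos (suc e) ℤ.+ pos b ℤ.* pos (suc d)) _      ≡⟨ cong (λ i → mkℚᵘ i (e + d * suc e)) (cong₂ ℤ._+_ (ℤ.pos-* a (suc e)) (ℤ.pos-* b (suc d))) ⟨
  mkℚᵘ (pos (a * suc e + b * suc d)) (e + d * suc e)  ≃⟨ toℚᵘ-/ (a * suc e + b * suc d) (e + d * suc e) ⟨
  toℚᵘ (pos (a * suc e + b * suc d) / (suc d * suc e)) ∎)
  where open ℚᵘ.≤-Reasoning

/-* : ∀ a b d e .{{_ : NonZero d}} .{{_ : NonZero e}} .{{_ : NonZero (d * e)}} →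
  (pos a / d) *ℚ (pos b / e) ≡ pos (a * b) / (d * e)
/-* a b (suc d) (suc e) = ℚ.toℚᵘ-injective (begin-equality
  toℚᵘ ((pos a / suc d) *ℚ (pos b / suc e))             ≃⟨ ℚ.toℚᵘ-homo-* (pos a / suc d) (pos b / suc e) ⟩
  toℚᵘ (pos a / suc d) ℚᵘ.* toℚᵘ (pos b / suc e)        ≃⟨ ℚᵘ.*-cong (toℚᵘ-/ a d) (toℚᵘ-/ b e) ⟩
  mkℚᵘ (pos a ℤ.* pos b) _                              ≡⟨ cong (λ i → mkℚᵘ i (e + d * suc e)) (ℤ.pos-* a b) ⟨
  mkℚᵘ (pos (a * b)) (e + d * suc e)                  ≃⟨ toℚᵘ-/ (a * b) (e + d * suc e) ⟨
  toℚᵘ (pos (a * b) / (suc d * suc e))                ∎)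
  where open ℚᵘ.≤-Reasoning

/-≤1 : ∀ {a d} .{{_ : NonZero d}} → a ≤ d → pos a / d ≤ℚ 1ℚ
/-≤1 {a} {suc d} a≤d = ℚ.toℚᵘ-cancel-≤ (ℚᵘ.≤-trans (ℚᵘ.≤-reflexive (toℚᵘ-/ a d))
  (*≤* (subst₂ ℤ._≤_ (sym (ℤ.*-identityʳ (pos a))) (sym (ℤ.*-identityˡ (pos (suc d)))) (+≤+ a≤d))))

/-≡1⇒ : ∀ {a d} .{{_ : NonZero d}} → pos a / d ≡ 1ℚ → a ≡ d
/-≡1⇒ {a} {suc d} eq with *≡* e ← ℚ./-injective-≃ (mkℚᵘ (pos a) d) (mkℚᵘ (pos 1) 0) eq =
  ℤ.+-injective (trans (sym (ℤ.*-identityʳ (pos a))) (trans e (ℤ.*-identityˡ (pos (suc d)))))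

sumℚ-/ : ∀ {B : Set} (f : B → ℚ) (m : B → ℕ) d .{{_ : NonZero d}} → (∀ u → f u ≡ pos (m u) / d) →
  ∀ us → sumℚ (map f us) ≡ pos (L.sum (map m us)) / d
sumℚ-/ f m d f≡ []       = /-≡ 0 0 1 d refl
sumℚ-/ f m d@(suc _) f≡ (u ∷ us) = begin
  f u +ℚ sumℚ (map f us)                           ≡⟨ cong₂ _+ℚ_ (f≡ u) (sumℚ-/ f m d f≡ us) ⟩
  (pos (m u) / d) +ℚ (pos (L.sum (map m us)) / d)          ≡⟨ /-+ (m u) (L.sum (map m us)) d d ⟩
  pos (m u * d + L.sum (map m us) * d) / (d * d)     ≡⟨ /-≡ (m u * d + L.sum (map m us) * d) (m u + L.sum (map m us)) (d * d) d
                                                       (ring₁ (m u) (L.sum (map m us)) d) ⟩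
  pos (m u + L.sum (map m us)) / d                   ∎
  where
  open ≡-Reasoning
  ring₁ : ∀ a b d → (a * d + b * d) * d ≡ (a + b) * (d * d)
  ring₁ = solve-∀

≡-minus : ∀ {p q r} → p +ℚ q ≡ r → p ≡ r -ℚ q
≡-minus {p} {q} {r} p+q≡r = begin
  p                    ≡⟨ ℚ.+-identityʳ p ⟨
  p +ℚ 0ℚ              ≡⟨ cong (p +ℚ_) (ℚ.+-inverseʳ q) ⟨
  p +ℚ (q -ℚ q)        ≡⟨ ℚ.+-assoc p q (-ℚ q) ⟨
  p +ℚ q -ℚ q          ≡⟨ cong (_-ℚ q) p+q≡r ⟩
  r -ℚ q               ∎
  where open ≡-Reasoning

≤-minus : ∀ {p q r} → p +ℚ q ≤ℚ r → p ≤ℚ r -ℚ q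
≤-minus {p} {q} {r} p+q≤r = subst (_≤ℚ r -ℚ q) (sym (≡-minus refl)) (ℚ.+-monoˡ-≤ (-ℚ q) p+q≤r)

minus-≡ : ∀ {p q r} → p ≡ r -ℚ q → p +ℚ q ≡ r
minus-≡ {p} {q} {r} p≡ = begin
  p +ℚ q              ≡⟨ cong (_+ℚ q) p≡ ⟩
  r -ℚ q +ℚ q         ≡⟨ ℚ.+-assoc r (-ℚ q) q ⟩
  r +ℚ (-ℚ q +ℚ q)    ≡⟨ cong (r +ℚ_) (ℚ.+-inverseˡ q) ⟩
  r +ℚ 0ℚ             ≡⟨ ℚ.+-identityʳ r ⟩
  r                   ∎
  where open ≡-Reasoning

2*C2 : ∀ m → 2 * (suc m C 2) ≡ suc m * m
2*C2 zero    = refl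
2*C2 (suc m) = begin
  2 * (suc (suc m) C 2)            ≡⟨ cong (2 *_) (nCk+nC[k+1]≡[n+1]C[k+1] (suc m) 1) ⟨
  2 * (suc m C 1 + suc m C 2)      ≡⟨ *-distribˡ-+ 2 (suc m C 1) (suc m C 2) ⟩
  2 * (suc m C 1) + 2 * (suc m C 2) ≡⟨ cong₂ (λ a b → 2 * a + b) (nC1≡n (suc m)) (2*C2 m) ⟩
  2 * suc m + suc m * m            ≡⟨ ring₁ m ⟩
  suc (suc m) * suc m              ∎
  where
  open ≡-Reasoning
  ring₁ : ∀ m → 2 * (1 + m) + (1 + m) * m ≡ (2 + m) * (1 + m)
  ring₁ = solve-∀

<⇒<ᵇ≡true : ∀ {m n} → m < n → (m <ᵇ n) ≡ true
<⇒<ᵇ≡true m<n = Equivalence.to T-≡ (<⇒<ᵇ m<n)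

≮⇒<ᵇ≡false : ∀ {m n} → ¬ m < n → (m <ᵇ n) ≡ false
≮⇒<ᵇ≡false {m} {n} m≮n = ¬-not λ m<ᵇn → m≮n (<ᵇ⇒< m n (Equivalence.from T-≡ m<ᵇn))

-- From clustering coefficients to D.

module NbhdEdges {n : ℕ} (G : Graph n) (k : ℕ) (regular : Regular k G) where
  open RegularCounting G k regular

  below : Fin n → Fin n → ℕ
  below v w = b2n (toℕ v <ᵇ toℕ w)

  triangle : Fin n → Fin n → Fin n → ℕ
  triangle u v w = A u v * (A u w * A v w)

  b2n-∧ : ∀ a b → b2n (a ∧ b) ≡ b2n a * b2n b
  b2n-∧ true  b = sym (+-identityʳ (b2n b))
  b2n-∧ false b = refl

  nbhdEdges≡ : ∀ u → nbhdEdges G u ≡ sum (λ v → sum (λ w → below v w * triangle u v w))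
  nbhdEdges≡ u = trans (listSum≡sum _) (sum-cong-≗ λ v → trans (listSum≡sum _) (sum-cong-≗ λ w →
    trans (b2n-∧ (toℕ v <ᵇ toℕ w) _) (cong (below v w *_)
      (trans (b2n-∧ (adj G u v) _) (cong (A u v *_) (b2n-∧ (adj G u w) _))))))

  triangle-sym : ∀ u v w → triangle u v w ≡ triangle u w v
  triangle-sym u v w = trans (cong (λ t → A u v * (A u w * t)) (A-sym v w)) (*-CSG.x∙yz≈y∙xz (A u v) (A u w) (A w v))

  below-total : ∀ u v w → triangle u v w ≡ below v w * triangle u v w + below w v * triangle u w v
  below-total u v w with <-cmp (toℕ v) (toℕ w)
  ... | tri< v<w _ v≯w rewrite <⇒<ᵇ≡true v<w | ≮⇒<ᵇ≡false v≯w =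
    sym (trans (+-identityʳ _) (+-identityʳ _))
  ... | tri> v≮w _ v>w rewrite <⇒<ᵇ≡true v>w | ≮⇒<ᵇ≡false v≮w =
    trans (triangle-sym u v w) (sym (+-identityʳ _))
  ... | tri≈ _ v≡w _ rewrite toℕ-injective v≡w | A-refl w | *-zeroʳ (A u w) | *-zeroʳ (A u w) = sym (trans (cong₂ _+_ (*-zeroʳ (below w w)) (*-zeroʳ (below w w))) refl)

  2nbhdEdges : ∀ u → nbhdEdges G u + nbhdEdges G u ≡ sum (λ v → sum (triangle u v))
  2nbhdEdges u = begin
    nbhdEdges G u + nbhdEdges G u
      ≡⟨ cong₂ _+_ (nbhdEdges≡ u) (trans (nbhdEdges≡ u) (∑-comm _)) ⟩
    sum (λ v → sum (λ w → below v w * triangle u v w)) + sum (λ v → sum (λ w → below w v * triangle u w v))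
      ≡⟨ trans (sum-cong-≗ λ v → ∑-distrib-+ _ _) (∑-distrib-+ _ _) ⟨
    sum (λ v → sum (λ w → below v w * triangle u v w + below w v * triangle u w v))
      ≡⟨ sum-cong-≗ (λ v → sum-cong-≗ λ w → below-total u v w) ⟨
    sum (λ v → sum (triangle u v)) ∎
    where open ≡-Reasoning

  -- The k² ordered pairs of neighbours of u are sorted into equal pairs (k), adjacent pairs (each
  -- edge twice) and non-adjacent distinct pairs (D).
  nbhdEdges+D : ∀ u → k * k ≡ k + (2 * nbhdEdges G u + D u)
  nbhdEdges+D u = begin
    k * k
      ≡⟨ cong (k *_) (sum-A u) ⟨
    k * sum (A u)
      ≡⟨ *-distribˡ-sum k (A u) ⟩
    sum (λ v → k * A u v)
      ≡⟨ sum-cong-≗ (λ v → trans (*-comm k (A u v)) (cong (A u v *_) (degree-split u v))) ⟩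
    sum (λ v → A u v * (A u v + (sum (λ z → A v z * A u z) + c u v)))
      ≡⟨ trans (sum-+* (A u) _ _) (cong₂ _+_ refl (sum-+* (A u) _ _)) ⟩
    sum (λ v → A u v * A u v) + (sum (λ v → A u v * sum (λ z → A v z * A u z)) + D u)
      ≡⟨ cong₂ _+_ (trans (sum-cong-≗ λ v → idem v) (sum-A u)) (cong₂ _+_ (sum-cong-≗ λ v → row v) refl) ⟩
    k + (sum (λ v → sum (triangle u v)) + D u)
      ≡⟨ cong (λ t → k + (t + D u)) (trans (sym (2nbhdEdges u)) (cong (nbhdEdges G u +_) (sym (+-identityʳ _)))) ⟩
    k + (2 * nbhdEdges G u + D u) ∎
    where
    open ≡-Reasoning
    idem : ∀ v → A u v * A u v ≡ A u v
    idem v with adj G u v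
    ... | true  = refl
    ... | false = refl
    row : ∀ v → A u v * sum (λ z → A v z * A u z) ≡ sum (triangle u v)
    row v = trans (*-distribˡ-sum (A u v) _) (sum-cong-≗ λ z → cong (A u v *_) (*-comm (A v z) (A u z)))

  totalEdges : ℕ
  totalEdges = sum (nbhdEdges G)

  totalEdges+D : n * (k * k) ≡ n * k + (2 * totalEdges + sum D)
  totalEdges+D = begin
    n * (k * k)                                        ≡⟨ sum-const n (k * k) ⟨
    sum {n} (λ _ → k * k)                              ≡⟨ sum-cong-≗ nbhdEdges+D ⟩
    sum (λ u → k + (2 * nbhdEdges G u + D u))          ≡⟨ trans (∑-distrib-+ _ _) (cong₂ _+_ (sum-const n k) (∑-distrib-+ _ _)) ⟩
    n * k + (sum (λ u → 2 * nbhdEdges G u) + sum D)    ≡⟨ cong (λ t → n * k + (t + sum D)) (*-distribˡ-sum 2 (nbhdEdges G)) ⟨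
    n * k + (2 * totalEdges + sum D)                   ∎
    where open ≡-Reasoning

average+/ : ∀ S n d e .{{_ : NonZero n}} .{{_ : NonZero d}} .{{_ : NonZero e}} .{{_ : NonZero (n * d * e)}} →
  ((pos 1 / n) *ℚ (pos S / d)) +ℚ (pos 6 / e) ≡ pos (1 * S * e + 6 * (n * d)) / (n * d * e)
average+/ S n@(suc _) d@(suc _) e@(suc _) =
  trans (cong (_+ℚ (pos 6 / e)) (/-* 1 S n d)) (/-+ (1 * S) 6 (n * d) e)

module Average {n₁ k₂ : ℕ} (G : Graph (suc n₁)) (regular : Regular (suc (suc k₂)) G) where
  n k K B : ℕ
  n = suc n₁
  k = suc (suc k₂)
  K = k C 2
  B = k * suc k

  open RegularCounting G k regular
  open NbhdEdges G k regular

  -- Numerator and denominator of C(G) + 6/(k(k+1)) over the common denominator; the bound becomes X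
  -- ≤ Y, and equality X = Y.
  X Y : ℕ
  X = 1 * totalEdges * B + 6 * (n * K)
  Y = n * K * B

  K-nonZero : NonZero K
  K-nonZero = choose2-nonZero k₂

  Y-nonZero : NonZero Y
  Y-nonZero = m*n≢0 (n * K) B {{m*n≢0 n K {{_}} {{K-nonZero}}}}

  clustering-average : clustering G ≡ (pos 1 / n) *ℚ ((pos totalEdges / K) {{K-nonZero}})
  clustering-average = cong ((pos 1 / n) *ℚ_) (trans
    (sumℚ-/ (localClustering G) (nbhdEdges G) K {{K-nonZero}} (λ u → cong (ratioC (nbhdEdges G u)) (regular u)) (allFin n))
    (cong (λ S → (pos S / K) {{K-nonZero}}) (listSum≡sum (nbhdEdges G))))

  clustering+6/B : clustering G +ℚ (pos 6 / B) ≡ (pos X / Y) {{Y-nonZero}}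
  clustering+6/B = trans (cong (_+ℚ (pos 6 / B)) clustering-average)
    (average+/ totalEdges n K B {{_}} {{K-nonZero}} {{_}} {{Y-nonZero}})

  -- Both sides are moved so that no subtraction occurs.
  excess-identity : 2 * X + k * (suc k * sum D + n * 6) ≡ 2 * Y + k * (n * (6 * k))
  -- The added term completes `2 * totalEdges + sum D` to the right-hand side of `totalEdges+D`.
  excess-identity = +-cancelʳ-≡ (B * (n * k)) _ _ (begin
    2 * X + k * (suc k * sum D + n * 6) + B * (n * k)
      ≡⟨ ring₁ totalEdges n K k (suc k) (sum D) ⟩
    B * (n * k + (2 * totalEdges + sum D)) + (6 * n * (2 * K) + 6 * n * k)
      ≡⟨ cong₂ (λ a b → B * a + (6 * n * b + 6 * n * k)) (sym totalEdges+D) (2*C2 (suc k₂)) ⟩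
    B * (n * (k * k)) + (6 * n * (k * suc k₂) + 6 * n * k)
      ≡⟨ ring₂ n (suc k₂) (suc k) ⟩
    n * (k * suc k₂) * B + k * (n * (6 * k)) + B * (n * k)
      ≡⟨ cong (λ t → n * t * B + k * (n * (6 * k)) + B * (n * k)) (2*C2 (suc k₂)) ⟨
    n * (2 * K) * B + k * (n * (6 * k)) + B * (n * k)
      ≡⟨ cong (λ t → t + k * (n * (6 * k)) + B * (n * k)) (ring₃ n K B) ⟩
    2 * Y + k * (n * (6 * k)) + B * (n * k) ∎)
    where
    open ≡-Reasoning
    ring₁ : ∀ S n K k l D → 2 * (1 * S * (k * l) + 6 * (n * K)) + k * (l * D + n * 6) + k * l * (n * k)
      ≡ k * l * (n * k + (2 * S + D)) + (6 * n * (2 * K) + 6 * n * k)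
    ring₁ = solve-∀
    ring₂ : ∀ n j l → (1 + j) * l * (n * ((1 + j) * (1 + j))) + (6 * n * ((1 + j) * j) + 6 * n * (1 + j))
      ≡ n * ((1 + j) * j) * ((1 + j) * l) + (1 + j) * (n * (6 * (1 + j))) + (1 + j) * l * (n * (1 + j))
    ring₂ = solve-∀
    ring₃ : ∀ n K B → n * (2 * K) * B ≡ 2 * (n * K * B)
    ring₃ = solve-∀

  bound⇒X≤Y : n * (6 * k) ≤ suc k * sum D + n * 6 → X ≤ Y
  bound⇒X≤Y bound = *-cancelˡ-≤ 2 (+-cancelʳ-≤ (k * (suc k * sum D + n * 6)) _ _
    (≤-trans (≤-reflexive excess-identity) (+-monoʳ-≤ (2 * Y) (*-monoʳ-≤ k bound))))

  tight⇒Y≤X : suc k * sum D + n * 6 ≤ n * (6 * k) → Y ≤ X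
  tight⇒Y≤X tight = *-cancelˡ-≤ 2 (+-cancelʳ-≤ (k * (n * (6 * k))) _ _
    (≤-trans (≤-reflexive (sym excess-identity)) (+-monoʳ-≤ (2 * X) (*-monoʳ-≤ k tight))))

  X≡Y⇒tight : X ≡ Y → suc k * sum D + n * 6 ≤ n * (6 * k)
  X≡Y⇒tight X≡Y = *-cancelˡ-≤ k (≤-reflexive (+-cancelˡ-≡ (2 * X) _ _
    (trans excess-identity (cong (λ t → 2 * t + k * (n * (6 * k))) (sym X≡Y)))))

  clustering≤ : n * (6 * k) ≤ suc k * sum D + n * 6 → clustering G ≤ℚ clusteringBound k
  clustering≤ bound = ≤-minus (subst (_≤ℚ 1ℚ) (sym clustering+6/B) (/-≤1 {{Y-nonZero}} (bound⇒X≤Y bound)))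

  clustering≡⇒tight : clustering G ≡ clusteringBound k → suc k * sum D + n * 6 ≤ n * (6 * k)
  clustering≡⇒tight eq = X≡Y⇒tight (/-≡1⇒ {{Y-nonZero}} (trans (sym clustering+6/B) (minus-≡ eq)))

  tight⇒clustering≡ : n * (6 * k) ≤ suc k * sum D + n * 6 → suc k * sum D + n * 6 ≤ n * (6 * k) →
    clustering G ≡ clusteringBound k
  tight⇒clustering≡ bound tight = ≡-minus (trans clustering+6/B
    (/-≡ X 1 Y 1 {{Y-nonZero}} (trans (*-identityʳ X) (trans (≤-antisym (bound⇒X≤Y bound) (tight⇒Y≤X tight)) (sym (*-identityˡ Y))))))

theorem1 : (k n : ℕ) → 3 ≤ k → k + 2 ≤ n → (G : Graph n) → Connected G → Regular k G →
    (clustering G ≤ℚ clusteringBound k)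
    × (clustering G ≡ clusteringBound k ⇔ Σ ℕ (λ ℓ → (n ≡ ℓ * suc k) × (G ≅ G[ k , ℓ ])))
theorem1 (suc (suc k₂)) (suc n₁) 3≤k k+2≤n G connected regular =
  clustering≤ global-bound , mk⇔ extremal attained
  where
  k n : ℕ
  k = suc (suc k₂)
  n = suc n₁
  open Average G regular using (clustering≤; clustering≡⇒tight; tight⇒clustering≡)
  open Global G k regular connected k+2≤n

  extremal : clustering G ≡ clusteringBound k → Σ ℕ (λ ℓ → (n ≡ ℓ * suc k) × (G ≅ G[ k , ℓ ]))
  extremal eq = Ring.G≅Gkl G regular 3≤k connected zero (Tight.center-near 3≤k (clustering≡⇒tight eq))

  -- One copy would give n = k + 1, against n ≥ k + 2.
  2≤blocks : ∀ ℓ → n ≡ ℓ * suc k → 2 ≤ ℓ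
  2≤blocks zero          ()
  2≤blocks (suc zero)    n≡ = contradiction (≤-trans k+2≤n (≤-reflexive (trans n≡ (+-identityʳ (suc k)))))
    (<⇒≱ (≤-reflexive (+-comm 2 k)))
  2≤blocks (suc (suc _)) _  = s≤s (s≤s z≤n)

  attained : Σ ℕ (λ ℓ → (n ≡ ℓ * suc k) × (G ≅ G[ k , ℓ ])) → clustering G ≡ clusteringBound k
  attained (ℓ , n≡ , iso) =
    tight⇒clustering≡ global-bound (Converse.tight {ℓ = ℓ} G regular n≡ (2≤blocks ℓ n≡) iso)
theorem1 (suc zero) _ (s≤s ()) _ _ _ _
theorem1 (suc (suc _)) zero _ () _ _ _
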